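{- For every integer $k\ge1$ and every $s=0,\dots,k$ the identity $$\sum_{m=1}^{s}\sum_{m,s}(1!)^{\alpha_1}\cdots(s!)^{\alpha_s}\,C_{\alpha_1,\dots,\alpha_s}^{s,m,k}=(2s-1)!!\binom{k+s-1}{2s}$$ holds.
   Context: $(-1)!!=1$. For integers $k\ge1$, $1\le s\le k-1$, $1\le m\le s$ and nonnegative integers $\alpha_1,\dots,\alpha_s$ with $\sum_{i=1}^s\alpha_i=m$, $\sum_{i=1}^s i\alpha_i=s$, the numbers $C_{\alpha_1,\dots,\alpha_s}^{s,m,k}$ are the uniquely determined universal numbers (not depending on $u$) such that for every entire or meromorphic function $u$ on $\mathbb{C}$ the operator $A=u(z)\frac{d}{dz}$ satisfies $$A^{k}=u^k\Big(\frac{d}{dz}\Big)^k+\sum_{s=1}^{k-1}\Big(\sum_{m=1}^{s}u^{k-m}\sum_{m,s}C_{\alpha_1,\dots,\alpha_s}^{s,m,k}\Big(\frac{du}{dz}\Big)^{\alpha_1}\cdots\Big(\frac{d^su}{dz^s}\Big)^{\alpha_s}\Big)\Big(\frac{d}{dz}\Big)^{k-s},$$ where $\sum_{m,s}$ is over all nonnegative integers $\alpha_1,\dots,\alpha_s$ with $\sum_{i=1}^s\alpha_i=m$ and $\sum_{i=1}^s i\alpha_i=s$. Conventions: for $s=0$ the double sum $\sum_{m=1}^{s}\sum_{m,s}$ is understood to equal $1$ (coefficient of $u^k(d/dz)^k$), and $C_{\alpha_1,\dots,\alpha_k}^{k,m,k}=0$ (the coefficient of $(d/dz)^0$ in $A^k$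 is $0$). -}

module Defs where

open import Data.Nat.Base as ℕ using (ℕ; zero; suc; _∸_)
import Data.Nat.Properties as ℕₚ
open import Data.Integer.Base using (+_)
open import Data.Rational.Base as ℚ using (ℚ; 0ℚ; 1ℚ; ½; ∣_∣; Positive; positive)
import Data.Rational.Properties as ℚₚ
open import Data.Rational.Solver using (module +-*-Solver)
open import Data.Fin.Base using (Fin; toℕ)
open import Data.Nat.ListAction using (sum)
open import Data.List.Base using (List; []; _∷_; map; foldr; upTo; applyUpTo; allFin; cartesianProductWith; filter)
open import Data.List.Relation.Unary.All using (All)
open import Data.Vec.Base as Vec using (Vec; lookup)
open import Data.Product using (Σ; ∃; ∃-syntax; _×_; _,_)
open import Data.Sum.Base using (_⊎_)
open import Relation.Nullary.Decidable using (_×-dec_)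
open import Relation.Binary.PropositionalEquality using (_≡_; refl; sym; trans; cong; cong₂; subst)

-- Real numbers are Cauchy sequences of rationals; equality is _≃_, not _≡_.

IsCauchy : (ℕ → ℚ) → Set
IsCauchy x = ∀ ε → 0ℚ ℚ.< ε →
  ∃[ N ] (∀ m n → N ℕ.≤ m → N ℕ.≤ n → ∣ x m ℚ.- x n ∣ ℚ.≤ ε)

record ℝ : Set where
  constructor mkℝ
  field
    seq    : ℕ → ℚ
    cauchy : IsCauchy seq

open ℝ public

infix 4 _≃_ _≤ʳ_ _<ʳ_

_≃_ : ℝ → ℝ → Set
x ≃ y = ∀ ε → 0ℚ ℚ.< ε → ∃[ N ] (∀ n → N ℕ.≤ n → ∣ seq x n ℚ.- seq y n ∣ ℚ.≤ ε)

_≤ʳ_ : ℝ → ℝ → Set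
x ≤ʳ y = ∀ ε → 0ℚ ℚ.< ε → ∃[ N ] (∀ n → N ℕ.≤ n → seq x n ℚ.≤ seq y n ℚ.+ ε)

_<ʳ_ : ℝ → ℝ → Set
x <ʳ y = ∃[ ε ] (0ℚ ℚ.< ε × ∃[ N ] (∀ n → N ℕ.≤ n → seq x n ℚ.+ ε ℚ.≤ seq y n))

const-cauchy : ∀ q → IsCauchy (λ _ → q)
const-cauchy q ε 0<ε = 0 , λ _ _ _ _ →
  subst (λ t → ∣ t ∣ ℚ.≤ ε) (sym (ℚₚ.+-inverseʳ q)) (ℚₚ.<⇒≤ 0<ε)

neg-cauchy : ∀ {x} → IsCauchy x → IsCauchy (λ n → ℚ.- x n)
neg-cauchy {x} cx ε 0<ε with cx ε 0<ε
... | N , h = N , λ m n N≤m N≤n →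
  subst (ℚ._≤ ε) (trans (sym (ℚₚ.∣-p∣≡∣p∣ (x m ℚ.- x n))) (cong ∣_∣ (eq (x m) (x n)))) (h m n N≤m N≤n)
  where
  open +-*-Solver
  eq : ∀ a b → ℚ.- (a ℚ.- b) ≡ (ℚ.- a) ℚ.- (ℚ.- b)
  eq = solve 2 (λ a b → :- (a :- b) := (:- a) :- (:- b)) refl

+-cauchy : ∀ {x y} → IsCauchy x → IsCauchy y → IsCauchy (λ n → x n ℚ.+ y n)
+-cauchy {x} {y} cx cy ε 0<ε = M ℕ.⊔ N , bound
  where
  open +-*-Solver
  η : ℚ
  η = ½ ℚ.* ε
  0<η : 0ℚ ℚ.< η
  0<η = ℚₚ.positive⁻¹ η {{ℚₚ.pos*pos⇒pos ½ ε {{positive 0<ε}}}}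
  η+η≡ε : η ℚ.+ η ≡ ε
  η+η≡ε = trans (sym (ℚₚ.*-distribʳ-+ ε ½ ½)) (ℚₚ.*-identityˡ ε)
  hx = cx η 0<η
  hy = cy η 0<η
  M = Σ.proj₁ hx
  N = Σ.proj₁ hy
  eq : ∀ a b c d → (a ℚ.- b) ℚ.+ (c ℚ.- d) ≡ (a ℚ.+ c) ℚ.- (b ℚ.+ d)
  eq = solve 4 (λ a b c d → (a :- b) :+ (c :- d) := (a :+ c) :- (b :+ d)) refl
  bound : ∀ m n → M ℕ.⊔ N ℕ.≤ m → M ℕ.⊔ N ℕ.≤ n →
          ∣ (x m ℚ.+ y m) ℚ.- (x n ℚ.+ y n) ∣ ℚ.≤ ε
  bound m n p q = begin
    ∣ (x m ℚ.+ y m) ℚ.- (x n ℚ.+ y n) ∣   ≡⟨ cong ∣_∣ (eq (x m) (x n) (y m) (y n)) ⟨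
    ∣ (x m ℚ.- x n) ℚ.+ (y m ℚ.- y n) ∣   ≤⟨ ℚₚ.∣p+q∣≤∣p∣+∣q∣ (x m ℚ.- x n) (y m ℚ.- y n) ⟩
    ∣ x m ℚ.- x n ∣ ℚ.+ ∣ y m ℚ.- y n ∣
      ≤⟨ ℚₚ.+-mono-≤ {∣ x m ℚ.- x n ∣} {η} {∣ y m ℚ.- y n ∣} {η}
           (Σ.proj₂ hx m n (ℕₚ.m⊔n≤o⇒m≤o M N p) (ℕₚ.m⊔n≤o⇒m≤o M N q))
           (Σ.proj₂ hy m n (ℕₚ.m⊔n≤o⇒n≤o M N p) (ℕₚ.m⊔n≤o⇒n≤o M N q)) ⟩
    η ℚ.+ η                               ≡⟨ η+η≡ε ⟩
    ε                                     ∎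
    where open ℚₚ.≤-Reasoning

cauchy-bounded : ∀ {x} → IsCauchy x →
  ∃[ B ] (Positive B × ∃[ N ] (∀ n → N ℕ.≤ n → ∣ x n ∣ ℚ.≤ B))
cauchy-bounded {x} cx with cx 1ℚ (ℚₚ.positive⁻¹ 1ℚ)
... | N , h = ∣ x N ∣ ℚ.+ 1ℚ
            , ℚₚ.nonNeg+pos⇒pos ∣ x N ∣ {{ℚₚ.∣-∣-nonNeg (x N)}} 1ℚ
            , N , λ n N≤n → begin
    ∣ x n ∣                        ≡⟨ cong ∣_∣ (eq (x N) (x n)) ⟩
    ∣ x N ℚ.+ (x n ℚ.- x N) ∣      ≤⟨ ℚₚ.∣p+q∣≤∣p∣+∣q∣ (x N) (x n ℚ.- x N) ⟩
    ∣ x N ∣ ℚ.+ ∣ x n ℚ.- x N ∣    ≤⟨ ℚₚ.+-monoʳ-≤ ∣ x N ∣ (h n N N≤n ℕₚ.≤-refl) ⟩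
    ∣ x N ∣ ℚ.+ 1ℚ                 ∎
  where
  open ℚₚ.≤-Reasoning
  open +-*-Solver
  eq : ∀ a b → b ≡ a ℚ.+ (b ℚ.- a)
  eq = solve 2 (λ a b → b := a :+ (b :- a)) refl

*-mono-abs : ∀ {a b A B} → Positive A → ∣ a ∣ ℚ.≤ A → ∣ b ∣ ℚ.≤ B →
             ∣ a ℚ.* b ∣ ℚ.≤ A ℚ.* B
*-mono-abs {a} {b} {A} {B} posA a≤A b≤B = begin
  ∣ a ℚ.* b ∣       ≡⟨ ℚₚ.∣p*q∣≡∣p∣*∣q∣ a b ⟩
  ∣ a ∣ ℚ.* ∣ b ∣   ≤⟨ ℚₚ.*-monoʳ-≤-nonNeg ∣ b ∣ {{ℚₚ.∣-∣-nonNeg b}} a≤A ⟩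
  A ℚ.* ∣ b ∣       ≤⟨ ℚₚ.*-monoˡ-≤-nonNeg A {{ℚₚ.pos⇒nonNeg A {{posA}}}} b≤B ⟩
  A ℚ.* B           ∎
  where open ℚₚ.≤-Reasoning

*-cauchy′ : ∀ {x y} → IsCauchy x → IsCauchy y →
  ∀ A → Positive A → ∀ M₀ → (∀ n → M₀ ℕ.≤ n → ∣ x n ∣ ℚ.≤ A) →
  ∀ B → Positive B → ∀ N₀ → (∀ n → N₀ ℕ.≤ n → ∣ y n ∣ ℚ.≤ B) →
  IsCauchy (λ n → x n ℚ.* y n)
*-cauchy′ {x} {y} cx cy A posA M₀ hA B posB N₀ hB ε 0<ε =
  fin δ 0<δ Sδ≡ε
  where
  S : ℚ
  S = A ℚ.+ B
  posS : Positive S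
  posS = ℚₚ.pos+pos⇒pos A {{posA}} B {{posB}}
  S⁻¹ : ℚ
  S⁻¹ = ℚ.1/_ S {{ℚₚ.pos⇒nonZero S {{posS}}}}
  δ : ℚ
  δ = S⁻¹ ℚ.* ε
  0<δ : 0ℚ ℚ.< δ
  0<δ = ℚₚ.positive⁻¹ δ
    {{ℚₚ.pos*pos⇒pos S⁻¹ {{ℚₚ.1/pos⇒pos S {{posS}}}} ε {{positive 0<ε}}}}
  Sδ≡ε : S ℚ.* δ ≡ ε
  Sδ≡ε = trans (sym (ℚₚ.*-assoc S S⁻¹ ε))
        (trans (cong (ℚ._* ε) (ℚₚ.*-inverseʳ S {{ℚₚ.pos⇒nonZero S {{posS}}}})) (ℚₚ.*-identityˡ ε))
  eq : ∀ a b c d → (a ℚ.* (c ℚ.- d)) ℚ.+ (d ℚ.* (a ℚ.- b)) ≡ (a ℚ.* c) ℚ.- (b ℚ.* d)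
  eq = solve 4 (λ a b c d → (a :* (c :- d)) :+ (d :* (a :- b)) := (a :* c) :- (b :* d)) refl
    where open +-*-Solver
  fin : ∀ δ → 0ℚ ℚ.< δ → S ℚ.* δ ≡ ε →
    ∃[ K ] (∀ m n → K ℕ.≤ m → K ℕ.≤ n → ∣ (x m ℚ.* y m) ℚ.- (x n ℚ.* y n) ∣ ℚ.≤ ε)
  fin δ 0<δ Sδ≡ε = K , bound
    where
    hx = cx δ 0<δ
    hy = cy δ 0<δ
    M₁ = Σ.proj₁ hx
    N₁ = Σ.proj₁ hy
    K = (M₀ ℕ.⊔ N₀) ℕ.⊔ (M₁ ℕ.⊔ N₁)
    lo : ∀ i → K ℕ.≤ i → M₀ ℕ.⊔ N₀ ℕ.≤ i
    lo _ = ℕₚ.m⊔n≤o⇒m≤o (M₀ ℕ.⊔ N₀) (M₁ ℕ.⊔ N₁)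
    hi : ∀ i → K ℕ.≤ i → M₁ ℕ.⊔ N₁ ℕ.≤ i
    hi _ = ℕₚ.m⊔n≤o⇒n≤o (M₀ ℕ.⊔ N₀) (M₁ ℕ.⊔ N₁)
    bound : ∀ m n → K ℕ.≤ m → K ℕ.≤ n → ∣ (x m ℚ.* y m) ℚ.- (x n ℚ.* y n) ∣ ℚ.≤ ε
    bound m n p q = begin
      ∣ (x m ℚ.* y m) ℚ.- (x n ℚ.* y n) ∣
        ≡⟨ cong ∣_∣ (eq (x m) (x n) (y m) (y n)) ⟨
      ∣ (x m ℚ.* (y m ℚ.- y n)) ℚ.+ (y n ℚ.* (x m ℚ.- x n)) ∣
        ≤⟨ ℚₚ.∣p+q∣≤∣p∣+∣q∣ (x m ℚ.* (y m ℚ.- y n)) (y n ℚ.* (x m ℚ.- x n)) ⟩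
      ∣ x m ℚ.* (y m ℚ.- y n) ∣ ℚ.+ ∣ y n ℚ.* (x m ℚ.- x n) ∣
        ≤⟨ ℚₚ.+-mono-≤ {∣ x m ℚ.* (y m ℚ.- y n) ∣} {A ℚ.* δ}
                        {∣ y n ℚ.* (x m ℚ.- x n) ∣} {B ℚ.* δ}
             (*-mono-abs {x m} {y m ℚ.- y n} {A} {δ} posA
                (hA m (ℕₚ.m⊔n≤o⇒m≤o M₀ N₀ (lo m p)))
                (Σ.proj₂ hy m n (ℕₚ.m⊔n≤o⇒n≤o M₁ N₁ (hi m p)) (ℕₚ.m⊔n≤o⇒n≤o M₁ N₁ (hi n q))))
             (*-mono-abs {y n} {x m ℚ.- x n} {B} {δ} posB
                (hB n (ℕₚ.m⊔n≤o⇒n≤o M₀ N₀ (lo n q)))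
                (Σ.proj₂ hx m n (ℕₚ.m⊔n≤o⇒m≤o M₁ N₁ (hi m p)) (ℕₚ.m⊔n≤o⇒m≤o M₁ N₁ (hi n q)))) ⟩
      (A ℚ.* δ) ℚ.+ (B ℚ.* δ)   ≡⟨ ℚₚ.*-distribʳ-+ δ A B ⟨
      S ℚ.* δ                   ≡⟨ Sδ≡ε ⟩
      ε                         ∎
      where open ℚₚ.≤-Reasoning

*-cauchy : ∀ {x y} → IsCauchy x → IsCauchy y → IsCauchy (λ n → x n ℚ.* y n)
*-cauchy {x} {y} cx cy =
  let (A , posA , M₀ , hA) = cauchy-bounded {x} cx
      (B , posB , N₀ , hB) = cauchy-bounded {y} cy
  in *-cauchy′ {x} {y} cx cy A posA M₀ hA B posB N₀ hB

fromℚ : ℚ → ℝ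
fromℚ q = mkℝ (λ _ → q) (const-cauchy q)

infixl 6 _+ʳ_ _-ʳ_
infixl 7 _*ʳ_
infix  8 -ʳ_

_+ʳ_ : ℝ → ℝ → ℝ
x +ʳ y = mkℝ (λ n → seq x n ℚ.+ seq y n) (+-cauchy {seq x} {seq y} (cauchy x) (cauchy y))

-ʳ_ : ℝ → ℝ
-ʳ x = mkℝ (λ n → ℚ.- seq x n) (neg-cauchy {seq x} (cauchy x))

_-ʳ_ : ℝ → ℝ → ℝ
x -ʳ y = x +ʳ (-ʳ y)

_*ʳ_ : ℝ → ℝ → ℝ
x *ʳ y = mkℝ (λ n → seq x n ℚ.* seq y n) (*-cauchy {seq x} {seq y} (cauchy x) (cauchy y))

record ℂ : Set where
  constructor _+i_
  field
    re : ℝ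
    im : ℝ

open ℂ public

infix  4 _≈_ _#_
infixl 6 _+_ _-_
infixl 7 _*_
infixr 8 _^_

_≈_ : ℂ → ℂ → Set
z ≈ w = re z ≃ re w × im z ≃ im w

fromℕ : ℕ → ℂ
fromℕ n = fromℚ (+ n ℚ./ 1) +i fromℚ 0ℚ

_+_ : ℂ → ℂ → ℂ
z + w = (re z +ʳ re w) +i (im z +ʳ im w)

_-_ : ℂ → ℂ → ℂ
z - w = (re z -ʳ re w) +i (im z -ʳ im w)

_*_ : ℂ → ℂ → ℂ
z * w = (re z *ʳ re w -ʳ im z *ʳ im w) +i (re z *ʳ im w +ʳ im z *ʳ re w)

_^_ : ℂ → ℕ → ℂ
z ^ zero  = fromℕ 1
z ^ suc n = z * z ^ n

-- The square of the modulus; inequalities between moduli are stated between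
-- their squares throughout, which avoids square roots.
∣_∣² : ℂ → ℝ
∣ z ∣² = re z *ʳ re z +ʳ im z *ʳ im z

_#_ : ℂ → ℂ → Set
z # w = fromℚ 0ℚ <ʳ ∣ z - w ∣²

∑ : {I : Set} → List I → (I → ℂ) → ℂ
∑ is t = foldr _+_ (fromℕ 0) (map t is)

∏ : {I : Set} → List I → (I → ℂ) → ℂ
∏ is t = foldr _*_ (fromℕ 1) (map t is)

[1‥_] : ℕ → List ℕ
[1‥ n ] = applyUpTo suc n

Region : Set₁
Region = ℂ → Set

FunctionOn : Region → Set
FunctionOn D = (z : ℂ) → D z → ℂ

-- The open disc |z - c| < r, for rational r > 0.
Disc : ℂ → ℚ → Region
Disc c r z = ∣ z - c ∣² <ʳ fromℚ (r ℚ.* r)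

IsOpen : Region → Set
IsOpen D = ∀ z → D z → ∃[ r ] (0ℚ ℚ.< r × (∀ w → Disc z r w → D w))

-- The ε-δ definition in the form
-- |f w - f z - f′ z (w - z)| ≤ ε |w - z| whenever |w - z| < δ.
IsDerivative : {D : Region} → FunctionOn D → FunctionOn D → Set
IsDerivative {D} f f′ =
  ∀ z (d : D z) ε → 0ℚ ℚ.< ε → ∃[ δ ] (0ℚ ℚ.< δ ×
    (∀ w (e : D w) → Disc z δ w →
      ∣ f w e - f z d - f′ z d * (w - z) ∣² ≤ʳ fromℚ (ε ℚ.* ε) *ʳ ∣ w - z ∣²))

IsHolomorphic : {D : Region} → FunctionOn D → Set
IsHolomorphic {D} f = IsOpen D × ∃[ f′ ] IsDerivative f f′

IsEntire : {D : Region} → FunctionOn D → Set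
IsEntire {D} f = (∀ z → D z) × IsHolomorphic f

-- f is holomorphic on its domain D, and in every disc |z| < R it has only
-- finitely many singularities, all of them poles (or removable): after
-- multiplication by finitely many factors z - p it extends holomorphically to
-- the whole disc.  Listing a point several times allows poles of higher order.
IsMeromorphic : {D : Region} → FunctionOn D → Set
IsMeromorphic {D} f = IsHolomorphic f × (∀ R → 0ℚ ℚ.< R →
  Σ (List ℂ) λ ps → Σ (FunctionOn (Disc (fromℕ 0) R)) λ g →
    IsHolomorphic g ×
    (∀ z → Disc (fromℕ 0) R z → All (z #_) ps → D z) ×
    (∀ z (b : Disc (fromℕ 0) R z) (d : D z) → ∏ ps (λ p → z - p) * f z d ≈ g z b))

IsEntireOrMeromorphic : {D : Region} → FunctionOn D → Set
IsEntireOrMeromorphic f = IsEntire f ⊎ IsMeromorphic f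

AreDerivatives : {D : Region} → FunctionOn D → (ℕ → FunctionOn D) → Set
AreDerivatives {D} f F =
  (∀ z (d : D z) → F 0 z d ≈ f z d) × (∀ n → IsDerivative (F n) (F (suc n)))

_∩_ : Region → Region → Region
(D ∩ E) z = D z × E z

-- G n = A ^ n f for the operator A = u d/dz, on the common domain of u and f.
AreIterates : {D E : Region} → FunctionOn D → FunctionOn E → (ℕ → FunctionOn (D ∩ E)) → Set
AreIterates {D} {E} u f G =
  (∀ z (d : D z) (e : E z) → G 0 z (d , e) ≈ f z e) ×
  (∀ n → Σ (FunctionOn (D ∩ E)) λ G′ → IsDerivative (G n) G′ ×
    (∀ z (d : D z) (e : E z) → G (suc n) z (d , e) ≈ u z d * G′ z (d , e)))

-- A vector α of length s lists α₁, …, αₛ, so the entry at position i : Fin s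
-- is α with index suc (toℕ i).
weight : ∀ {s} → Vec ℕ s → ℕ
weight {s} α = sum (map (λ i → suc (toℕ i) ℕ.* lookup α i) (allFin s))

vectors≤ : (b s : ℕ) → List (Vec ℕ s)
vectors≤ b zero    = Vec.[] ∷ []
vectors≤ b (suc s) = cartesianProductWith Vec._∷_ (upTo (suc b)) (vectors≤ b s)

-- All α with Σ αᵢ = m and Σ i αᵢ = s; the first condition forces αᵢ ≤ m.
indices : (s m : ℕ) → List (Vec ℕ s)
indices s m =
  filter (λ α → (Vec.sum α ℕₚ.≟ m) ×-dec (weight α ℕₚ.≟ s)) (vectors≤ m s)

-- Σ_{m=1}^s Σ_{m,s}, with the convention that the value for s = 0 is 1.
∑∑ : (s : ℕ) → (ℕ → Vec ℕ s → ℂ) → ℂ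
∑∑ zero      t = fromℕ 1
∑∑ s@(suc _) t = ∑ [1‥ s ] λ m → ∑ (indices s m) λ α → t m α

-- C k s m α stands for the number with upper indices s, m, k and lower indices α.
Coefficients : Set
Coefficients = (k s m : ℕ) → Vec ℕ s → ℂ

Expansion : Coefficients → Set₁
Expansion C =
  ∀ k → 1 ℕ.≤ k →
  ∀ {D E : Region} (u : FunctionOn D) (f : FunctionOn E) →
  IsEntireOrMeromorphic u → IsEntireOrMeromorphic f →
  ∀ U F G → AreDerivatives u U → AreDerivatives f F → AreIterates u f G →
  ∀ z (d : D z) (e : E z) →
  G k z (d , e) ≈
    u z d ^ k * F k z e +
    ∑ [1‥ k ∸ 1 ] λ s →
      ∑∑ s (λ m α → u z d ^ (k ∸ m) *
        (C k s m α * ∏ (allFin s) λ i → U (suc (toℕ i)) z d ^ lookup α i))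
      * F (k ∸ s) z e

-- The convention for s = k.
TopZero : Coefficients → Set
TopZero C =
  ∀ k m (α : Vec ℕ k) → 1 ℕ.≤ k → 1 ℕ.≤ m → m ℕ.≤ k →
  Vec.sum α ≡ m → weight α ≡ k → C k k m α ≈ fromℕ 0

IsUniversal : Coefficients → Set₁
IsUniversal C = Expansion C × TopZero C

-- (2s - 1)!!, where (-1)!! = 1.
[2_-1]!! : ℕ → ℕ
[2 zero  -1]!! = 1
[2 suc s -1]!! = (2 ℕ.* s ℕ.+ 1) ℕ.* [2 s -1]!!

{-# OPTIONS --safe #-}
module Submission where

-- Since the coefficients are universal, it suffices to test the expansion on one pair u, f at the point 0.
-- Take u = 1 + z + ⋯ + zᵏ and f = zʲ with j = k - s.  Then u(0) = 1 and u⁽ⁱ⁾(0) = i! for i ≤ k, while j! is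
-- the only nonzero derivative of f at 0, so the expansion says that (Aᵏ zʲ)(0) is j! times the sum in question.
-- The numbers (Aᵏ zʲ)(0) satisfy a recursion in k, from A zⁿ = n (zⁿ⁻¹ + zⁿ + ⋯), which Pascal's rule solves.

open import Defs
open import Data.Nat.Base using (ℕ; suc; _≤_; _∸_; _!) renaming (_+_ to _+ℕ_; _*_ to _*ℕ_)
open import Data.Nat.Combinatorics using (_C_)
open import Data.Fin.Base using (toℕ)
open import Data.List.Base using (allFin)
open import Data.Vec.Base using (lookup)

open import Algebra.Bundles using (CommutativeRing)
import Algebra.Solver.Ring.Simple as RingSolver
open import Algebra.Solver.Ring.AlmostCommutativeRing using (fromCommutativeRing)
open import Data.Fin.Properties using (toℕ<n)
open import Data.Integer.Base as ℤ using (+_)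
import Data.Integer.Solver as ℤSolver
open import Data.List.Base using (List; []; _∷_; _++_; map; concatMap; applyUpTo)
open import Data.List.Properties using (map-++)
open import Data.List.Relation.Unary.All as All using (All; []; _∷_)
open import Data.List.Relation.Unary.All.Properties using (applyUpTo⁺₁; all-filter)
open import Data.Nat.Base as ℕ using (zero; _<_; _⊔_; z≤n; s≤s; z<s; s<s; NonZero)
open import Data.Nat.Combinatorics using (nCk+nC[k+1]≡[n+1]C[k+1]; k>n⇒nCk≡0; nC1≡n)
open import Data.Nat.ListAction using (sum)
open import Data.Nat.ListAction.Properties using (sum-++)
open import Data.Nat.Properties as ℕₚ
  using (+-identityʳ; +-suc; +-cancelˡ-≡; *-assoc; *-identityˡ; *-identityʳ; *-zeroʳ; *-distribˡ-+; *-distribʳ-+;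
         ≤-refl; ≤-trans; ≤-reflexive; <-≤-trans; <-cmp; m≤m+n; n≤1+n; suc-injective)
open import Data.Nat.Tactic.RingSolver using (solve-∀)
open import Data.Product using (_×_; _,_; proj₁; proj₂; ∃-syntax)
open import Data.Product.Properties using (≡-dec)
open import Data.Rational.Base as ℚ using (ℚ; 0ℚ; 1ℚ; ½; ∣_∣)
import Data.Rational.Properties as ℚₚ
import Data.Rational.Solver as ℚSolver
open import Data.Rational.Unnormalised.Base as ℚᵘ using (mkℚᵘ; *≡*)
import Data.Rational.Unnormalised.Properties as ℚᵘₚ
open import Data.Sum.Base using (_⊎_; inj₁; inj₂)
open import Data.Unit.Base using (⊤; tt)
open import Data.Vec.Base as Vec using (Vec)
open import Function.Base using (_∘_)
open import Relation.Binary.Definitions using (tri<; tri≈; tri>)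
open import Relation.Binary.PropositionalEquality
  using (_≡_; _≢_; refl; sym; trans; cong; cong₂; subst; subst₂; isEquivalence; module ≡-Reasoning)
open import Relation.Nullary using (contradiction)

-- Iterates on monomials

-- The weights i! are the derivatives at 0 of 1/(1 - z). For this untruncated u, the variable w = z
-- - z²/2 turns A into d/dw, and z = 1 - √(1 - 2w); this is where the double factorials come from:
-- with s = k - n, the value of Aᵏ zⁿ at 0 is n! (2s - 1)!! C(n + 2s - 1, 2s). Truncation makes u a
-- polynomial on the whole plane and keeps every sum finite. It leaves these values unchanged,
-- because exponents above the remaining number of applications contribute nothing at 0. Two values
-- of s escape the test functions: s = 0 is a convention, and s = k would need j = 0, while the
-- expansion has no term of order 0, so there `TopZero` is used. The analytic work is to show from
-- the ε-δ definition that the formal derivative of a polynomial is its derivative. Complex numbers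
-- are pairs of Cauchy sequences, so the estimates are made on rational approximations, uniformly on
-- bounded sets.

[1+k]*[1+n]C[1+k]≡[1+n]*nCk : ∀ n k → suc k *ℕ (suc n C suc k) ≡ suc n *ℕ (n C k)
[1+k]*[1+n]C[1+k]≡[1+n]*nCk n zero = begin
  1 *ℕ (suc n C 1)   ≡⟨ *-identityˡ _ ⟩
  suc n C 1          ≡⟨ nC1≡n (suc n) ⟩
  suc n              ≡⟨ *-identityʳ _ ⟨
  suc n *ℕ 1         ∎
  where open ≡-Reasoning

[1+k]*[1+n]C[1+k]≡[1+n]*nCk zero (suc k) = begin
  suc (suc k) *ℕ (1 C suc (suc k))   ≡⟨ cong (suc (suc k) *ℕ_) (k>n⇒nCk≡0 {1} {suc (suc k)} (s<s z<s)) ⟩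
  suc (suc k) *ℕ 0                   ≡⟨ *-zeroʳ (suc (suc k)) ⟩
  0                                  ≡⟨⟩
  1 *ℕ 0                             ≡⟨ cong (1 *ℕ_) (k>n⇒nCk≡0 {0} {suc k} z<s) ⟨
  1 *ℕ (0 C suc k)                   ∎
  where open ≡-Reasoning

[1+k]*[1+n]C[1+k]≡[1+n]*nCk (suc n) (suc k) = begin
  suc (suc k) *ℕ (suc (suc n) C suc (suc k))
    ≡⟨ cong (suc (suc k) *ℕ_) (nCk+nC[k+1]≡[n+1]C[k+1] (suc n) (suc k)) ⟨
  suc (suc k) *ℕ (a +ℕ (suc n C suc (suc k)))
    ≡⟨ split (suc k) a _ ⟩
  (a +ℕ suc k *ℕ a) +ℕ suc (suc k) *ℕ (suc n C suc (suc k))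
    ≡⟨ cong₂ (λ p q → (a +ℕ p) +ℕ q) ([1+k]*[1+n]C[1+k]≡[1+n]*nCk n k) ([1+k]*[1+n]C[1+k]≡[1+n]*nCk n (suc k)) ⟩
  (a +ℕ suc n *ℕ (n C k)) +ℕ suc n *ℕ (n C suc k)
    ≡⟨ merge a (suc n) (n C k) _ ⟩
  a +ℕ suc n *ℕ ((n C k) +ℕ (n C suc k))
    ≡⟨ cong (λ p → a +ℕ suc n *ℕ p) (nCk+nC[k+1]≡[n+1]C[k+1] n k) ⟩
  suc (suc n) *ℕ a ∎
  where
  open ≡-Reasoning
  a = suc n C suc k
  split : ∀ k a b → suc k *ℕ (a +ℕ b) ≡ (a +ℕ k *ℕ a) +ℕ suc k *ℕ b
  split = solve-∀
  merge : ∀ a n b c → (a +ℕ n *ℕ b) +ℕ n *ℕ c ≡ a +ℕ n *ℕ (b +ℕ c)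
  merge = solve-∀

-- Adding (k + 1) C(n, k) to the left side gives (k + 1) C(n + 1, k + 1) by Pascal's rule, which the
-- preceding identity evaluates. Writing n as k + m avoids truncated subtraction.
[1+k]*nC[1+k]≡[n-k]*nCk : ∀ m k → suc k *ℕ ((k +ℕ m) C suc k) ≡ m *ℕ ((k +ℕ m) C k)
[1+k]*nC[1+k]≡[n-k]*nCk m k = +-cancelˡ-≡ (suc k *ℕ (n C k)) _ _ (begin
  suc k *ℕ (n C k) +ℕ suc k *ℕ (n C suc k)   ≡⟨ *-distribˡ-+ (suc k) (n C k) _ ⟨
  suc k *ℕ ((n C k) +ℕ (n C suc k))          ≡⟨ cong (suc k *ℕ_) (nCk+nC[k+1]≡[n+1]C[k+1] n k) ⟩
  suc k *ℕ (suc n C suc k)                   ≡⟨ [1+k]*[1+n]C[1+k]≡[1+n]*nCk n k ⟩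
  (suc k +ℕ m) *ℕ (n C k)                    ≡⟨ *-distribʳ-+ (n C k) (suc k) m ⟩
  suc k *ℕ (n C k) +ℕ m *ℕ (n C k)           ∎)
  where
  open ≡-Reasoning
  n = k +ℕ m

-- The value at 0 of Aᵏ zⁿ, for the operator A = (1 + z + ⋯ + zᴹ⁻¹) d/dz.
monomialAt0 : ℕ → ℕ → ℕ → ℕ
monomialAt0 M zero    zero    = 1
monomialAt0 M zero    (suc n) = 0
monomialAt0 M (suc k) n       = n *ℕ sum (applyUpTo (λ i → monomialAt0 M k (n ∸ 1 +ℕ i)) M)

sum-zero : ∀ f L → (∀ i → i < L → f i ≡ 0) → sum (applyUpTo f L) ≡ 0
sum-zero f zero    h = refl
sum-zero f (suc L) h = cong₂ _+ℕ_ (h 0 z<s) (sum-zero (λ i → f (suc i)) L (λ i i<L → h (suc i) (s<s i<L)))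

sum-cong : ∀ {f g} L → (∀ i → f i ≡ g i) → sum (applyUpTo f L) ≡ sum (applyUpTo g L)
sum-cong zero    h = refl
sum-cong (suc L) h = cong₂ _+ℕ_ (h 0) (sum-cong L (λ i → h (suc i)))

sum-*ˡ : ∀ c f L → sum (applyUpTo (λ i → c *ℕ f i) L) ≡ c *ℕ sum (applyUpTo f L)
sum-*ˡ c f zero    = sym (*-zeroʳ c)
sum-*ˡ c f (suc L) = trans (cong (c *ℕ f 0 +ℕ_) (sum-*ˡ c (λ i → f (suc i)) L)) (sym (*-distribˡ-+ c (f 0) _))

-- One application of the operator lowers the order of vanishing at 0 by at most one.
monomialAt0-above : ∀ M k n → k < n → monomialAt0 M k n ≡ 0
monomialAt0-above M zero    (suc n) _         = refl
monomialAt0-above M (suc k) (suc n) (s<s k<n) = begin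
  suc n *ℕ sum (applyUpTo (λ i → monomialAt0 M k (n +ℕ i)) M)
    ≡⟨ cong (suc n *ℕ_) (sum-zero _ M (λ i _ → monomialAt0-above M k (n +ℕ i) (<-≤-trans k<n (m≤m+n n i)))) ⟩
  suc n *ℕ 0   ≡⟨ *-zeroʳ (suc n) ⟩
  0            ∎
  where open ≡-Reasoning

closedForm : ℕ → ℕ → ℕ
closedForm n s = n ! *ℕ ([2 s -1]!! *ℕ ((n +ℕ s +ℕ s ∸ 1) C (s +ℕ s)))

-- The value of Σ_{i ≥ n} monomialAt0 M (n + s) i.
tailForm : ℕ → ℕ → ℕ
tailForm n s = n ! *ℕ ([2 s -1]!! *ℕ ((n +ℕ s +ℕ s) C (s +ℕ s)))

suc*tailForm : ∀ n s → suc n *ℕ tailForm n s ≡ closedForm (suc n) s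
suc*tailForm n s = sym (*-assoc (suc n) (n !) _)

n+[1+t]+[1+t]∸1 : ∀ n t → n +ℕ suc t +ℕ suc t ∸ 1 ≡ suc (t +ℕ t +ℕ n)
n+[1+t]+[1+t]∸1 n t = cong (_∸ 1) (lemma n t)
  where
  lemma : ∀ n t → n +ℕ suc t +ℕ suc t ≡ suc (suc (t +ℕ t +ℕ n))
  lemma = solve-∀

-- Put N = 2t + n + 1. Absorption turns (n + 1) C(N, 2t) into (2t + 1) C(N, 2t + 1). The factor 2t +
-- 1 completes the double factorial, and Pascal's rule adds C(N, 2t + 1) and C(N, 2t + 2).
tail-step : ∀ n t → closedForm n (suc t) +ℕ tailForm (suc n) t ≡ tailForm n (suc t)
tail-step n t = begin
  closedForm n (suc t) +ℕ tailForm (suc n) t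
    ≡⟨ cong₂ (λ p q → n ! *ℕ ([2 suc t -1]!! *ℕ p) +ℕ suc n ! *ℕ ([2 t -1]!! *ℕ q))
         (cong₂ _C_ (trans (n+[1+t]+[1+t]∸1 n t) (sym (+-suc (t +ℕ t) n))) (+-suc (suc t) t))
         (cong (_C (t +ℕ t)) (e₁ n t)) ⟩
  n ! *ℕ ((2 *ℕ t +ℕ 1) *ℕ d *ℕ x) +ℕ (suc n *ℕ n !) *ℕ (d *ℕ y)
    ≡⟨ r₁ (n !) t d x n y ⟩
  n ! *ℕ d *ℕ ((2 *ℕ t +ℕ 1) *ℕ x +ℕ suc n *ℕ y)
    ≡⟨ cong (λ p → n ! *ℕ d *ℕ ((2 *ℕ t +ℕ 1) *ℕ x +ℕ p)) ([1+k]*nC[1+k]≡[n-k]*nCk (suc n) (t +ℕ t)) ⟨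
  n ! *ℕ d *ℕ ((2 *ℕ t +ℕ 1) *ℕ x +ℕ suc (t +ℕ t) *ℕ w)
    ≡⟨ r₂ (n !) t d x w ⟩
  n ! *ℕ ((2 *ℕ t +ℕ 1) *ℕ d *ℕ (w +ℕ x))
    ≡⟨ cong (λ p → n ! *ℕ ((2 *ℕ t +ℕ 1) *ℕ d *ℕ p)) (nCk+nC[k+1]≡[n+1]C[k+1] N (suc (t +ℕ t))) ⟩
  n ! *ℕ ((2 *ℕ t +ℕ 1) *ℕ d *ℕ (suc N C suc (suc (t +ℕ t))))
    ≡⟨ cong (λ p → n ! *ℕ ((2 *ℕ t +ℕ 1) *ℕ d *ℕ p)) (cong₂ _C_ (e₂ n t) (sym (+-suc (suc t) t))) ⟩
  tailForm n (suc t) ∎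
  where
  open ≡-Reasoning
  d = [2 t -1]!!
  N = t +ℕ t +ℕ suc n
  x = N C suc (suc (t +ℕ t))
  y = N C (t +ℕ t)
  w = N C suc (t +ℕ t)
  e₁ : ∀ n t → suc n +ℕ t +ℕ t ≡ t +ℕ t +ℕ suc n
  e₁ = solve-∀
  e₂ : ∀ n t → suc (t +ℕ t +ℕ suc n) ≡ n +ℕ suc t +ℕ suc t
  e₂ = solve-∀
  r₁ : ∀ f t d x n y → f *ℕ ((2 *ℕ t +ℕ 1) *ℕ d *ℕ x) +ℕ (suc n *ℕ f) *ℕ (d *ℕ y)
                     ≡ f *ℕ d *ℕ ((2 *ℕ t +ℕ 1) *ℕ x +ℕ suc n *ℕ y)
  r₁ = solve-∀
  r₂ : ∀ f t d x w → f *ℕ d *ℕ ((2 *ℕ t +ℕ 1) *ℕ x +ℕ suc (t +ℕ t) *ℕ w) ≡ f *ℕ ((2 *ℕ t +ℕ 1) *ℕ d *ℕ (w +ℕ x))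
  r₂ = solve-∀

-- Mutual induction: the closed form at `suc k` needs the tail sum at `k`, and the tail sum splits
-- off its first term while n + s stays equal to k. Of the exponents n, n + 1, ... only n, ..., n +
-- s contribute, hence the conditions `s < M` and `s < L`.
monomialAt0-closed : ∀ M k n s → s < M → n +ℕ s ≡ k → monomialAt0 M k n ≡ closedForm n s
monomialAt0-tail : ∀ M k L n s → s < L → L ≤ M → n +ℕ s ≡ k →
         sum (applyUpTo (λ i → monomialAt0 M k (n +ℕ i)) L) ≡ tailForm n s

monomialAt0-closed M k zero (suc s) _ refl = sym (begin
  1 *ℕ ([2 suc s -1]!! *ℕ ((s +ℕ suc s) C (suc s +ℕ suc s)))
    ≡⟨ cong (λ p → 1 *ℕ ([2 suc s -1]!! *ℕ p)) (k>n⇒nCk≡0 {s +ℕ suc s} ≤-refl) ⟩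
  1 *ℕ ([2 suc s -1]!! *ℕ 0)   ≡⟨ cong (1 *ℕ_) (*-zeroʳ [2 suc s -1]!!) ⟩
  0                            ∎)
  where open ≡-Reasoning

monomialAt0-closed M k zero zero _ refl = refl
monomialAt0-closed M (suc k) (suc n) s s<M eq = begin
  suc n *ℕ sum (applyUpTo (λ i → monomialAt0 M k (n +ℕ i)) M)
    ≡⟨ cong (suc n *ℕ_) (monomialAt0-tail M k M n s s<M ≤-refl (suc-injective eq)) ⟩
  suc n *ℕ tailForm n s   ≡⟨ suc*tailForm n s ⟩
  closedForm (suc n) s    ∎
  where open ≡-Reasoning

monomialAt0-tail M k (suc L) n s s<L L≤M eq = begin
  monomialAt0 M k (n +ℕ 0) +ℕ sum (applyUpTo (λ i → monomialAt0 M k (n +ℕ suc i)) L)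
    ≡⟨ cong₂ _+ℕ_ (cong (monomialAt0 M k) (+-identityʳ n)) (sum-cong L (λ i → cong (monomialAt0 M k) (+-suc n i))) ⟩
  monomialAt0 M k n +ℕ sum (applyUpTo (λ i → monomialAt0 M k (suc n +ℕ i)) L)
    ≡⟨ rest s s<L eq ⟩
  tailForm n s ∎
  where
  open ≡-Reasoning
  rest : ∀ s → s < suc L → n +ℕ s ≡ k →
         monomialAt0 M k n +ℕ sum (applyUpTo (λ i → monomialAt0 M k (suc n +ℕ i)) L) ≡ tailForm n s
  -- Here n = k, so only the first term survives; the two binomial coefficients differ in the upper
  -- index alone, and the lower index is 0.
  rest zero s<L eq = trans (cong₂ _+ℕ_
    (trans (monomialAt0-closed M k n 0 (<-≤-trans s<L L≤M) eq) (c0 (n +ℕ 0 +ℕ 0 ∸ 1) (n +ℕ 0 +ℕ 0)))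
    (sum-zero _ L (λ i _ → monomialAt0-above M k (suc n +ℕ i)
      (s≤s (≤-trans (≤-reflexive (trans (sym eq) (+-identityʳ n))) (m≤m+n n i)))))) (+-identityʳ _)
    where
    c0 : ∀ p q → n ! *ℕ (1 *ℕ (p C 0)) ≡ n ! *ℕ (1 *ℕ (q C 0))
    c0 p q = refl
  rest (suc t) (s<s t<L) eq = begin
    monomialAt0 M k n +ℕ sum (applyUpTo (λ i → monomialAt0 M k (suc n +ℕ i)) L)
      ≡⟨ cong₂ _+ℕ_ (monomialAt0-closed M k n (suc t) (≤-trans (s<s t<L) L≤M) eq)
           (monomialAt0-tail M k L (suc n) t t<L (≤-trans (n≤1+n L) L≤M) (trans (sym (+-suc n t)) eq)) ⟩
    closedForm n (suc t) +ℕ tailForm (suc n) t   ≡⟨ tail-step n t ⟩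
    tailForm n (suc t)                           ∎

-- Polynomials as lists of terms

-- The pair (a , n) stands for the term a zⁿ.
Poly : Set
Poly = List (ℕ × ℕ)

deriv : ℕ × ℕ → ℕ × ℕ
deriv (a , n) = a *ℕ n , n ∸ 1

mulGeom : ℕ → ℕ × ℕ → Poly
mulGeom M (a , n) = applyUpTo (λ i → a , n +ℕ i) M

-- The operator (1 + z + ⋯ + zᴹ⁻¹) d/dz; in particular A 1 is d/dz.
A : ℕ → Poly → Poly
A M = concatMap (λ t → mulGeom M (deriv t))

_^A_ : ∀ M → ℕ → Poly → Poly
(M ^A zero)  p = p
(M ^A suc k) p = A M ((M ^A k) p)

-- `_^A_` adds each new application on the outside, whereas the recursion of `monomialAt0` applies
-- the operator to the monomial first. This reconciles the two orders.
^A-comm : ∀ M k p → (M ^A k) (A M p) ≡ A M ((M ^A k) p)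
^A-comm M zero    p = refl
^A-comm M (suc k) p = cong (A M) (^A-comm M k p)

-- The value at 0 of (A M)ᵏ p.
valueAt0 : ℕ → ℕ → Poly → ℕ
valueAt0 M k p = sum (map (λ (a , n) → a *ℕ monomialAt0 M k n) p)

valueAt0-applyUpTo : ∀ M k g a L →
  valueAt0 M k (applyUpTo (λ i → a , g i) L) ≡ sum (applyUpTo (λ i → a *ℕ monomialAt0 M k (g i)) L)
valueAt0-applyUpTo M k g a zero    = refl
valueAt0-applyUpTo M k g a (suc L) = cong (a *ℕ monomialAt0 M k (g 0) +ℕ_) (valueAt0-applyUpTo M k (λ i → g (suc i)) a L)

valueAt0-A : ∀ M k p → valueAt0 M k (A M p) ≡ valueAt0 M (suc k) p
valueAt0-A M k []            = refl
valueAt0-A M k ((a , n) ∷ p) = begin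
  sum (map v (q ++ A M p))                 ≡⟨ cong sum (map-++ v q (A M p)) ⟩
  sum (map v q ++ map v (A M p))           ≡⟨ sum-++ (map v q) _ ⟩
  valueAt0 M k q +ℕ valueAt0 M k (A M p)
    ≡⟨ cong₂ _+ℕ_ (valueAt0-applyUpTo M k (n ∸ 1 +ℕ_) (a *ℕ n) M) (valueAt0-A M k p) ⟩
  sum (applyUpTo (λ i → a *ℕ n *ℕ monomialAt0 M k (n ∸ 1 +ℕ i)) M) +ℕ valueAt0 M (suc k) p
    ≡⟨ cong (_+ℕ valueAt0 M (suc k) p) (trans (sum-*ˡ (a *ℕ n) _ M) (*-assoc a n _)) ⟩
  a *ℕ monomialAt0 M (suc k) n +ℕ valueAt0 M (suc k) p  ∎
  where
  open ≡-Reasoning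
  v : ℕ × ℕ → ℕ
  v (a , n) = a *ℕ monomialAt0 M k n
  q = mulGeom M (deriv (a , n))

valueAt0-^A : ∀ M k p → valueAt0 M 0 ((M ^A k) p) ≡ valueAt0 M k p
valueAt0-^A M zero    p = refl
valueAt0-^A M (suc k) p = begin
  valueAt0 M 0 (A M ((M ^A k) p))   ≡⟨ cong (valueAt0 M 0) (^A-comm M k p) ⟨
  valueAt0 M 0 ((M ^A k) (A M p))   ≡⟨ valueAt0-^A M k (A M p) ⟩
  valueAt0 M k (A M p)              ≡⟨ valueAt0-A M k p ⟩
  valueAt0 M (suc k) p              ∎
  where open ≡-Reasoning

-- For M = 1 the operator is d/dz, so these numbers are the derivatives of zⁿ at 0.
monomialAt0₁-diag : ∀ n → monomialAt0 1 n n ≡ n !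
monomialAt0₁-diag zero    = refl
monomialAt0₁-diag (suc n) = cong (suc n *ℕ_)
  (trans (+-identityʳ _) (trans (cong (monomialAt0 1 n) (+-identityʳ n)) (monomialAt0₁-diag n)))

monomialAt0₁-below : ∀ k n → n < k → monomialAt0 1 k n ≡ 0
monomialAt0₁-below (suc k) zero    _         = refl
monomialAt0₁-below (suc k) (suc n) (s<s n<k) = trans
  (cong (suc n *ℕ_) (trans (+-identityʳ _) (trans (cong (monomialAt0 1 k) (+-identityʳ n)) (monomialAt0₁-below k n n<k))))
  (*-zeroʳ (suc n))

monomialAt0₁-off : ∀ k n → k ≢ n → monomialAt0 1 k n ≡ 0
monomialAt0₁-off k n k≢n with <-cmp k n
... | tri< k<n _ _ = monomialAt0-above 1 k n k<n
... | tri≈ _ k≡n _ = contradiction k≡n k≢n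
... | tri> _ _ n<k = monomialAt0₁-below k n n<k

geom : ℕ → Poly
geom M = mulGeom M (1 , 0)

sum-pick : ∀ f L i → i < L → (∀ j → j ≢ i → f j ≡ 0) → sum (applyUpTo f L) ≡ f i
sum-pick f (suc L) zero    _         h = trans
  (cong (f 0 +ℕ_) (sum-zero (λ i → f (suc i)) L (λ i _ → h (suc i) (λ ())))) (+-identityʳ _)
sum-pick f (suc L) (suc i) (s<s i<L) h = cong₂ _+ℕ_ (h 0 (λ ()))
  (sum-pick (λ i → f (suc i)) L i i<L (λ j j≢i → h (suc j) (λ e → j≢i (suc-injective e))))

valueAt0-geom : ∀ M i → i < M → valueAt0 1 i (geom M) ≡ i !
valueAt0-geom M i i<M = begin
  valueAt0 1 i (geom M)                              ≡⟨ valueAt0-applyUpTo 1 i (λ j → j) 1 M ⟩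
  sum (applyUpTo (λ j → 1 *ℕ monomialAt0 1 i j) M)
    ≡⟨ sum-pick _ M i i<M (λ j j≢i → cong (1 *ℕ_) (monomialAt0₁-off i j (λ e → j≢i (sym e)))) ⟩
  1 *ℕ monomialAt0 1 i i                             ≡⟨ *-identityˡ _ ⟩
  monomialAt0 1 i i                                  ≡⟨ monomialAt0₁-diag i ⟩
  i !                                                ∎
  where open ≡-Reasoning

-- Gaussian rationals

ℚ[i] : Set
ℚ[i] = ℚ × ℚ

infixl 6 _⊕_ _⊖_
infixl 7 _⊗_
infix  8 ⊝_
infixr 8 _↑_
infix  9 _at_

_⊕_ _⊖_ _⊗_ : ℚ[i] → ℚ[i] → ℚ[i]
(a , b) ⊕ (c , d) = a ℚ.+ c , b ℚ.+ d
(a , b) ⊗ (c , d) = a ℚ.* c ℚ.- b ℚ.* d , a ℚ.* d ℚ.+ b ℚ.* c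

⊝_ : ℚ[i] → ℚ[i]
⊝ (a , b) = ℚ.- a , ℚ.- b

x ⊖ y = x ⊕ ⊝ y

natℚ : ℕ → ℚ
natℚ n = + n ℚ./ 1

ι : ℕ → ℚ[i]
ι n = natℚ n , 0ℚ

_↑_ : ℚ[i] → ℕ → ℚ[i]
x ↑ zero  = ι 1
x ↑ suc n = x ⊗ x ↑ n

-- Arithmetic on `ℂ` is termwise, so `_at_` commutes with it by definition. Identities between
-- complex numbers thus become identities of Gaussian rationals at each index, with `_≡_` and a ring
-- solver available.
_at_ : ℂ → ℕ → ℚ[i]
z at n = seq (re z) n , seq (im z) n

ℚ[i]-commutativeRing : CommutativeRing _ _
ℚ[i]-commutativeRing = record
  { Carrier = ℚ[i]
  ; _≈_ = _≡_
  ; _+_ = _⊕_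
  ; _*_ = _⊗_
  ; -_ = ⊝_
  ; 0# = ι 0
  ; 1# = ι 1
  ; isCommutativeRing = record
    { isRing = record
      { +-isAbelianGroup = record
        { isGroup = record
          { isMonoid = record
            { isSemigroup = record
              { isMagma = record { isEquivalence = isEquivalence ; ∙-cong = cong₂ _⊕_ }
              ; assoc = λ (a , b) (c , d) (e , f) → cong₂ _,_ (ℚₚ.+-assoc a c e) (ℚₚ.+-assoc b d f)
              }
            ; identity = (λ (a , b) → cong₂ _,_ (ℚₚ.+-identityˡ a) (ℚₚ.+-identityˡ b))
                       , (λ (a , b) → cong₂ _,_ (ℚₚ.+-identityʳ a) (ℚₚ.+-identityʳ b))
            }
          ; inverse = (λ (a , b) → cong₂ _,_ (ℚₚ.+-inverseˡ a) (ℚₚ.+-inverseˡ b))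
                    , (λ (a , b) → cong₂ _,_ (ℚₚ.+-inverseʳ a) (ℚₚ.+-inverseʳ b))
          ; ⁻¹-cong = cong ⊝_
          }
        ; comm = λ (a , b) (c , d) → cong₂ _,_ (ℚₚ.+-comm a c) (ℚₚ.+-comm b d)
        }
      ; *-cong = cong₂ _⊗_
      ; *-assoc = λ (a , b) (c , d) (e , f) → cong₂ _,_
          (solve 6 (λ a b c d e f → (a :* c :- b :* d) :* e :- (a :* d :+ b :* c) :* f
                                 := a :* (c :* e :- d :* f) :- b :* (c :* f :+ d :* e)) refl a b c d e f)
          (solve 6 (λ a b c d e f → (a :* c :- b :* d) :* f :+ (a :* d :+ b :* c) :* e
                                 := a :* (c :* f :+ d :* e) :+ b :* (c :* e :- d :* f)) refl a b c d e f)
      ; *-identity = (λ (a , b) → cong₂ _,_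
                        (solve 2 (λ a b → con 1ℚ :* a :- con 0ℚ :* b := a) refl a b)
                        (solve 2 (λ a b → con 1ℚ :* b :+ con 0ℚ :* a := b) refl a b))
                   , (λ (a , b) → cong₂ _,_
                        (solve 2 (λ a b → a :* con 1ℚ :- b :* con 0ℚ := a) refl a b)
                        (solve 2 (λ a b → a :* con 0ℚ :+ b :* con 1ℚ := b) refl a b))
      ; distrib = (λ (a , b) (c , d) (e , f) → cong₂ _,_
                     (solve 6 (λ a b c d e f → a :* (c :+ e) :- b :* (d :+ f)
                                            := (a :* c :- b :* d) :+ (a :* e :- b :* f)) refl a b c d e f)
                     (solve 6 (λ a b c d e f → a :* (d :+ f) :+ b :* (c :+ e)
                                            := (a :* d :+ b :* c) :+ (a :* f :+ b :* e)) refl a b c d e f))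
                , (λ (a , b) (c , d) (e , f) → cong₂ _,_
                     (solve 6 (λ a b c d e f → (c :+ e) :* a :- (d :+ f) :* b
                                            := (c :* a :- d :* b) :+ (e :* a :- f :* b)) refl a b c d e f)
                     (solve 6 (λ a b c d e f → (c :+ e) :* b :+ (d :+ f) :* a
                                            := (c :* b :+ d :* a) :+ (e :* b :+ f :* a)) refl a b c d e f))
      }
    ; *-comm = λ (a , b) (c , d) → cong₂ _,_
        (solve 4 (λ a b c d → a :* c :- b :* d := c :* a :- d :* b) refl a b c d)
        (solve 4 (λ a b c d → a :* d :+ b :* c := c :* b :+ d :* a) refl a b c d)
    }
  }
  where open ℚSolver.+-*-Solver

module ℚ[i] = CommutativeRing ℚ[i]-commutativeRing
module ℚ[i]-Solver = RingSolver (fromCommutativeRing ℚ[i]-commutativeRing) (≡-dec ℚₚ._≟_ ℚₚ._≟_)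

-- Division normalises by a gcd, which does not compute for a variable n; unnormalised rationals
-- reduce the claim to an integer identity.
natℚ-suc : ∀ n → natℚ (suc n) ≡ 1ℚ ℚ.+ natℚ n
natℚ-suc n = ℚₚ.toℚᵘ-injective (begin
  ℚ.toℚᵘ (natℚ (suc n))            ≈⟨ ℚₚ.toℚᵘ-fromℚᵘ (mkℚᵘ (+ suc n) 0) ⟩
  mkℚᵘ (+ suc n) 0                 ≈⟨ *≡* (cross-multiplied (+ n)) ⟩
  mkℚᵘ (+ 1) 0 ℚᵘ.+ mkℚᵘ (+ n) 0   ≈⟨ ℚᵘₚ.+-congʳ (mkℚᵘ (+ 1) 0) (ℚₚ.toℚᵘ-fromℚᵘ (mkℚᵘ (+ n) 0)) ⟨
  ℚ.toℚᵘ 1ℚ ℚᵘ.+ ℚ.toℚᵘ (natℚ n)   ≈⟨ ℚₚ.toℚᵘ-homo-+ 1ℚ (natℚ n) ⟨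
  ℚ.toℚᵘ (1ℚ ℚ.+ natℚ n)           ∎)
  where
  open ℚᵘₚ.≃-Reasoning
  open ℤSolver.+-*-Solver
  cross-multiplied : ∀ n → (+ 1 ℤ.+ n) ℤ.* + 1 ≡ (+ 1 ℤ.* + 1 ℤ.+ n ℤ.* + 1) ℤ.* + 1
  cross-multiplied = solve 1 (λ n → (con (+ 1) :+ n) :* con (+ 1)
                                 := (con (+ 1) :* con (+ 1) :+ n :* con (+ 1)) :* con (+ 1)) refl

ι-suc : ∀ n → ι (suc n) ≡ ι 1 ⊕ ι n
ι-suc n = cong (_, 0ℚ) (natℚ-suc n)

ι-+ : ∀ m n → ι (m +ℕ n) ≡ ι m ⊕ ι n
ι-+ zero    n = sym (ℚ[i].+-identityˡ (ι n))
ι-+ (suc m) n = begin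
  ι (suc (m +ℕ n))    ≡⟨ ι-suc (m +ℕ n) ⟩
  ι 1 ⊕ ι (m +ℕ n)    ≡⟨ cong (ι 1 ⊕_) (ι-+ m n) ⟩
  ι 1 ⊕ (ι m ⊕ ι n)   ≡⟨ ℚ[i].+-assoc (ι 1) (ι m) (ι n) ⟨
  ι 1 ⊕ ι m ⊕ ι n     ≡⟨ cong (_⊕ ι n) (ι-suc m) ⟨
  ι (suc m) ⊕ ι n     ∎
  where open ≡-Reasoning

ι-* : ∀ m n → ι (m *ℕ n) ≡ ι m ⊗ ι n
ι-* zero    n = sym (ℚ[i].zeroˡ (ι n))
ι-* (suc m) n = begin
  ι (n +ℕ m *ℕ n)     ≡⟨ ι-+ n (m *ℕ n) ⟩
  ι n ⊕ ι (m *ℕ n)    ≡⟨ cong (ι n ⊕_) (ι-* m n) ⟩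
  ι n ⊕ ι m ⊗ ι n     ≡⟨ solve 2 (λ m n → n :+ m :* n := (con (ι 1) :+ m) :* n) refl (ι m) (ι n) ⟩
  (ι 1 ⊕ ι m) ⊗ ι n   ≡⟨ cong (_⊗ ι n) (ι-suc m) ⟨
  ι (suc m) ⊗ ι n     ∎
  where
  open ≡-Reasoning
  open ℚ[i]-Solver

-- The squared modulus: `norm (z at n)` is by definition the n-th term of `∣ z ∣²`.
norm : ℚ[i] → ℚ
norm (a , b) = a ℚ.* a ℚ.+ b ℚ.* b

-- The Brahmagupta-Fibonacci two-square identity.
norm-⊗ : ∀ x y → norm (x ⊗ y) ≡ norm x ℚ.* norm y
norm-⊗ (a , b) (c , d) = solve 4 (λ a b c d →
  (a :* c :- b :* d) :* (a :* c :- b :* d) :+ (a :* d :+ b :* c) :* (a :* d :+ b :* c)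
  := (a :* a :+ b :* b) :* (c :* c :+ d :* d)) refl a b c d
  where open ℚSolver.+-*-Solver

square≥0 : ∀ p → 0ℚ ℚ.≤ p ℚ.* p
square≥0 p with ℚₚ.≤-total 0ℚ p
... | inj₁ 0≤p = ℚₚ.nonNegative⁻¹ (p ℚ.* p) {{ℚₚ.nonNeg*nonNeg⇒nonNeg p {{ℚ.nonNegative 0≤p}} p {{ℚ.nonNegative 0≤p}}}}
... | inj₂ p≤0 = ℚₚ.nonNegative⁻¹ (p ℚ.* p) {{ℚₚ.nonPos*nonPos⇒nonPos p {{ℚ.nonPositive p≤0}} p {{ℚ.nonPositive p≤0}}}}

+-nonneg : ∀ {p q} → 0ℚ ℚ.≤ p → 0ℚ ℚ.≤ q → 0ℚ ℚ.≤ p ℚ.+ q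
+-nonneg 0≤p 0≤q = ℚₚ.+-mono-≤ 0≤p 0≤q

*-mono-≤-nonneg : ∀ {p q r s} → 0ℚ ℚ.≤ p → p ℚ.≤ q → 0ℚ ℚ.≤ r → r ℚ.≤ s → p ℚ.* r ℚ.≤ q ℚ.* s
*-mono-≤-nonneg {p} {q} {r} {s} 0≤p p≤q 0≤r r≤s = ℚₚ.≤-trans
  (ℚₚ.*-monoʳ-≤-nonNeg r {{ℚ.nonNegative 0≤r}} p≤q)
  (ℚₚ.*-monoˡ-≤-nonNeg q {{ℚ.nonNegative (ℚₚ.≤-trans 0≤p p≤q)}} r≤s)

*-nonneg : ∀ {p q} → 0ℚ ℚ.≤ p → 0ℚ ℚ.≤ q → 0ℚ ℚ.≤ p ℚ.* q
*-nonneg {p} {q} 0≤p 0≤q = ℚₚ.nonNegative⁻¹ (p ℚ.* q)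
  {{ℚₚ.nonNeg*nonNeg⇒nonNeg p {{ℚ.nonNegative 0≤p}} q {{ℚ.nonNegative 0≤q}}}}

norm≥0 : ∀ x → 0ℚ ℚ.≤ norm x
norm≥0 (a , b) = +-nonneg (square≥0 a) (square≥0 b)

2ℚ : ℚ
2ℚ = 1ℚ ℚ.+ 1ℚ

0≤1 : 0ℚ ℚ.≤ 1ℚ
0≤1 = ℚₚ.nonNegative⁻¹ 1ℚ

0≤2 : 0ℚ ℚ.≤ 2ℚ
0≤2 = ℚₚ.nonNegative⁻¹ 2ℚ

-- The parallelogram law with the norm of x ⊖ y dropped.
norm-⊕ : ∀ x y → norm (x ⊕ y) ℚ.≤ 2ℚ ℚ.* (norm x ℚ.+ norm y)
norm-⊕ x@(a , b) y@(c , d) = begin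
  norm (x ⊕ y)          ≡⟨ ℚₚ.+-identityʳ (norm (x ⊕ y)) ⟨
  norm (x ⊕ y) ℚ.+ 0ℚ   ≤⟨ ℚₚ.+-monoʳ-≤ (norm (x ⊕ y)) (norm≥0 (x ⊖ y)) ⟩
  norm (x ⊕ y) ℚ.+ norm (x ⊖ y)      ≡⟨ solve 4 (λ a b c d →
      ((a :+ c) :* (a :+ c) :+ (b :+ d) :* (b :+ d)) :+ ((a :- c) :* (a :- c) :+ (b :- d) :* (b :- d))
      := con 2ℚ :* ((a :* a :+ b :* b) :+ (c :* c :+ d :* d))) refl a b c d ⟩
  2ℚ ℚ.* (norm x ℚ.+ norm y)         ∎
  where
  open ℚₚ.≤-Reasoning
  open ℚSolver.+-*-Solver

norm-⊕-≤ : ∀ x y {p q} → norm x ℚ.≤ p → norm y ℚ.≤ q → norm (x ⊕ y) ℚ.≤ 2ℚ ℚ.* (p ℚ.+ q)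
norm-⊕-≤ x y x≤p y≤q = ℚₚ.≤-trans (norm-⊕ x y) (ℚₚ.*-monoˡ-≤-nonNeg 2ℚ (ℚₚ.+-mono-≤ x≤p y≤q))

norm-⊗-≤ : ∀ x y {p q} → norm x ℚ.≤ p → norm y ℚ.≤ q → norm (x ⊗ y) ℚ.≤ p ℚ.* q
norm-⊗-≤ x y x≤p y≤q = ℚₚ.≤-trans (ℚₚ.≤-reflexive (norm-⊗ x y)) (*-mono-≤-nonneg (norm≥0 x) x≤p (norm≥0 y) y≤q)

-- Differentiation of polynomials

LocallyBounded : (ℚ[i] → ℚ[i]) → Set
LocallyBounded f = ∀ R → 0ℚ ℚ.≤ R → ∃[ B ] (0ℚ ℚ.≤ B × (∀ x → norm x ℚ.≤ R → norm (f x) ℚ.≤ B))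

remainder : (f f′ : ℚ[i] → ℚ[i]) → ℚ[i] → ℚ[i] → ℚ[i]
remainder f f′ x h = f (x ⊕ h) ⊖ f x ⊖ f′ x ⊗ h

-- In squared moduli this is a remainder of order |h|². The bound is uniform over a ball because a
-- point of `ℂ` is seen only through its approximations, which move with the index. Restricting to
-- |h| ≤ 1 keeps x + h in a bounded set.
QuadraticRemainder : (f f′ : ℚ[i] → ℚ[i]) → Set
QuadraticRemainder f f′ = ∀ R → 0ℚ ℚ.≤ R → ∃[ B ] (0ℚ ℚ.≤ B × (∀ x h → norm x ℚ.≤ R → norm h ℚ.≤ 1ℚ →
  norm (remainder f f′ x h) ℚ.≤ B ℚ.* (norm h ℚ.* norm h)))

↑-bounded : ∀ n → LocallyBounded (_↑ n)
↑-bounded zero    R 0≤R = 1ℚ , 0≤1 , λ _ _ → ℚₚ.≤-refl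
↑-bounded (suc n) R 0≤R with ↑-bounded n R 0≤R
... | B , 0≤B , h = R ℚ.* B , *-nonneg 0≤R 0≤B , λ x x≤R → norm-⊗-≤ x (x ↑ n) x≤R (h x x≤R)

ι⊗-bounded : ∀ a f → LocallyBounded f → LocallyBounded (λ x → ι a ⊗ f x)
ι⊗-bounded a f bd R 0≤R with bd R 0≤R
... | B , 0≤B , h = norm (ι a) ℚ.* B , *-nonneg (norm≥0 (ι a)) 0≤B ,
  λ x x≤R → norm-⊗-≤ (ι a) (f x) ℚₚ.≤-refl (h x x≤R)

quadratic-const : ∀ c → QuadraticRemainder (λ _ → c) (λ _ → ι 0)
quadratic-const c R 0≤R = 0ℚ , ℚₚ.≤-refl , λ x h _ _ → ℚₚ.≤-reflexive
  (trans (cong norm (solve 2 (λ c h → c :- c :- con (ι 0) :* h := con (ι 0)) refl c h))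
         (sym (ℚₚ.*-zeroˡ (norm h ℚ.* norm h))))
  where open ℚ[i]-Solver

quadratic-+ : ∀ f f′ g g′ → QuadraticRemainder f f′ → QuadraticRemainder g g′ →
              QuadraticRemainder (λ x → f x ⊕ g x) (λ x → f′ x ⊕ g′ x)
quadratic-+ f f′ g g′ qf qg R 0≤R with qf R 0≤R | qg R 0≤R
... | B , 0≤B , hf | B′ , 0≤B′ , hg = 2ℚ ℚ.* (B ℚ.+ B′) , *-nonneg 0≤2 (+-nonneg 0≤B 0≤B′) , λ x h x≤R h≤1 → begin
  norm (remainder (λ x → f x ⊕ g x) (λ x → f′ x ⊕ g′ x) x h)
    ≡⟨ cong norm (solve 7 (λ a b c d p q h → (a :+ b) :- (c :+ d) :- (p :+ q) :* h
                                           := (a :- c :- p :* h) :+ (b :- d :- q :* h))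
         refl (f (x ⊕ h)) (g (x ⊕ h)) (f x) (g x) (f′ x) (g′ x) h) ⟩
  norm (remainder f f′ x h ⊕ remainder g g′ x h)
    ≤⟨ norm-⊕-≤ (remainder f f′ x h) (remainder g g′ x h) (hf x h x≤R h≤1) (hg x h x≤R h≤1) ⟩
  2ℚ ℚ.* (B ℚ.* (norm h ℚ.* norm h) ℚ.+ B′ ℚ.* (norm h ℚ.* norm h))
    ≡⟨ cong (2ℚ ℚ.*_) (ℚₚ.*-distribʳ-+ (norm h ℚ.* norm h) B B′) ⟨
  2ℚ ℚ.* ((B ℚ.+ B′) ℚ.* (norm h ℚ.* norm h))
    ≡⟨ ℚₚ.*-assoc 2ℚ (B ℚ.+ B′) _ ⟨
  2ℚ ℚ.* (B ℚ.+ B′) ℚ.* (norm h ℚ.* norm h) ∎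
  where
  open ℚₚ.≤-Reasoning
  open ℚ[i]-Solver

quadratic-ι⊗ : ∀ a f f′ → QuadraticRemainder f f′ → QuadraticRemainder (λ x → ι a ⊗ f x) (λ x → ι a ⊗ f′ x)
quadratic-ι⊗ a f f′ qf R 0≤R with qf R 0≤R
... | B , 0≤B , hf = norm (ι a) ℚ.* B , *-nonneg (norm≥0 (ι a)) 0≤B , λ x h x≤R h≤1 → begin
  norm (remainder (λ x → ι a ⊗ f x) (λ x → ι a ⊗ f′ x) x h)
    ≡⟨ cong norm (solve 5 (λ a b c d h → a :* b :- a :* c :- (a :* d) :* h := a :* (b :- c :- d :* h))
         refl (ι a) (f (x ⊕ h)) (f x) (f′ x) h) ⟩
  norm (ι a ⊗ remainder f f′ x h)
    ≤⟨ norm-⊗-≤ (ι a) (remainder f f′ x h) ℚₚ.≤-refl (hf x h x≤R h≤1) ⟩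
  norm (ι a) ℚ.* (B ℚ.* (norm h ℚ.* norm h))
    ≡⟨ ℚₚ.*-assoc (norm (ι a)) B _ ⟨
  norm (ι a) ℚ.* B ℚ.* (norm h ℚ.* norm h) ∎
  where
  open ℚₚ.≤-Reasoning
  open ℚ[i]-Solver

-- The remainder of x f is f′(x) h² + (x + h) r, where r is the remainder of f. The factor 2 (R + 1)
-- bounds the norm of x + h, and the outer 2 comes from `norm-⊕`.
quadratic-id⊗ : ∀ f f′ → LocallyBounded f′ → QuadraticRemainder f f′ →
                QuadraticRemainder (λ x → x ⊗ f x) (λ x → f x ⊕ x ⊗ f′ x)
quadratic-id⊗ f f′ bd qf R 0≤R with bd R 0≤R | qf R 0≤R
... | B′ , 0≤B′ , hB′ | B , 0≤B , hf =
  2ℚ ℚ.* (B′ ℚ.+ 2ℚ ℚ.* (R ℚ.+ 1ℚ) ℚ.* B) ,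
  *-nonneg 0≤2 (+-nonneg 0≤B′ (*-nonneg (*-nonneg 0≤2 (+-nonneg 0≤R 0≤1)) 0≤B)) , λ x h x≤R h≤1 → begin
  norm (remainder (λ x → x ⊗ f x) (λ x → f x ⊕ x ⊗ f′ x) x h)
    ≡⟨ cong norm (solve 5 (λ x h a b c → (x :+ h) :* a :- x :* b :- (b :+ x :* c) :* h
                                       := c :* (h :* h) :+ (x :+ h) :* (a :- b :- c :* h))
         refl x h (f (x ⊕ h)) (f x) (f′ x)) ⟩
  norm (f′ x ⊗ (h ⊗ h) ⊕ (x ⊕ h) ⊗ remainder f f′ x h)
    ≤⟨ norm-⊕-≤ (f′ x ⊗ (h ⊗ h)) ((x ⊕ h) ⊗ remainder f f′ x h)
         (norm-⊗-≤ (f′ x) (h ⊗ h) (hB′ x x≤R) (ℚₚ.≤-reflexive (norm-⊗ h h)))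
         (norm-⊗-≤ (x ⊕ h) (remainder f f′ x h) (norm-⊕-≤ x h x≤R h≤1) (hf x h x≤R h≤1)) ⟩
  2ℚ ℚ.* (B′ ℚ.* (norm h ℚ.* norm h) ℚ.+ 2ℚ ℚ.* (R ℚ.+ 1ℚ) ℚ.* (B ℚ.* (norm h ℚ.* norm h)))
    ≡⟨ Q.solve 4 (λ c s b n → Q.con 2ℚ Q.:* (c Q.:* n Q.:+ s Q.:* (b Q.:* n))
                         Q.:= Q.con 2ℚ Q.:* (c Q.:+ s Q.:* b) Q.:* n)
         refl B′ (2ℚ ℚ.* (R ℚ.+ 1ℚ)) B (norm h ℚ.* norm h) ⟩
  2ℚ ℚ.* (B′ ℚ.+ 2ℚ ℚ.* (R ℚ.+ 1ℚ) ℚ.* B) ℚ.* (norm h ℚ.* norm h) ∎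
  where
  open ℚₚ.≤-Reasoning
  open ℚ[i]-Solver
  module Q = ℚSolver.+-*-Solver

quadratic-cong : ∀ f {f′ g′} → (∀ x → f′ x ≡ g′ x) → QuadraticRemainder f f′ → QuadraticRemainder f g′
quadratic-cong f f′≡g′ qf R 0≤R with qf R 0≤R
... | B , 0≤B , hf = B , 0≤B , λ x h x≤R h≤1 →
  subst (λ d → norm (f (x ⊕ h) ⊖ f x ⊖ d ⊗ h) ℚ.≤ B ℚ.* (norm h ℚ.* norm h)) (f′≡g′ x) (hf x h x≤R h≤1)

quadratic-↑ : ∀ n → QuadraticRemainder (_↑ n) (λ x → ι n ⊗ x ↑ (n ∸ 1))
quadratic-↑ zero    = quadratic-cong (_↑ 0) (λ x → sym (ℚ[i].zeroˡ (ι 1))) (quadratic-const (ι 1))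
quadratic-↑ (suc n) = quadratic-cong (_↑ suc n) (step n)
  (quadratic-id⊗ (_↑ n) (λ x → ι n ⊗ x ↑ (n ∸ 1))
    (ι⊗-bounded n (_↑ (n ∸ 1)) (↑-bounded (n ∸ 1))) (quadratic-↑ n))
  where
  open ≡-Reasoning
  open ℚ[i]-Solver
  step : ∀ n x → x ↑ n ⊕ x ⊗ (ι n ⊗ x ↑ (n ∸ 1)) ≡ ι (suc n) ⊗ x ↑ n
  step zero    x = solve 1 (λ x → con (ι 1) :+ x :* (con (ι 0) :* con (ι 1)) := con (ι 1) :* con (ι 1)) refl x
  step (suc n) x = begin
    x ↑ suc n ⊕ x ⊗ (ι (suc n) ⊗ x ↑ n)
      ≡⟨ solve 3 (λ x p m → x :* p :+ x :* (m :* p) := (con (ι 1) :+ m) :* (x :* p)) refl x (x ↑ n) (ι (suc n)) ⟩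
    (ι 1 ⊕ ι (suc n)) ⊗ x ↑ suc n
      ≡⟨ cong (_⊗ x ↑ suc n) (ι-suc (suc n)) ⟨
    ι (suc (suc n)) ⊗ x ↑ suc n ∎

evalAt : Poly → ℚ[i] → ℚ[i]
evalAt []            x = ι 0
evalAt ((a , n) ∷ p) x = ι a ⊗ x ↑ n ⊕ evalAt p x

quadratic-evalAt : ∀ p → QuadraticRemainder (evalAt p) (evalAt (map deriv p))
quadratic-evalAt []            = quadratic-const (ι 0)
quadratic-evalAt ((a , n) ∷ p) = quadratic-+
  (λ x → ι a ⊗ x ↑ n) (λ x → ι (a *ℕ n) ⊗ x ↑ (n ∸ 1)) (evalAt p) (evalAt (map deriv p))
  (quadratic-cong (λ x → ι a ⊗ x ↑ n)
    (λ x → trans (sym (ℚ[i].*-assoc (ι a) (ι n) (x ↑ (n ∸ 1)))) (cong (_⊗ x ↑ (n ∸ 1)) (sym (ι-* a n))))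
    (quadratic-ι⊗ a (_↑ n) (λ x → ι n ⊗ x ↑ (n ∸ 1)) (quadratic-↑ n)))
  (quadratic-evalAt p)

evalAt-++ : ∀ p q x → evalAt (p ++ q) x ≡ evalAt p x ⊕ evalAt q x
evalAt-++ []            q x = sym (ℚ[i].+-identityˡ (evalAt q x))
evalAt-++ ((a , n) ∷ p) q x = trans (cong (ι a ⊗ x ↑ n ⊕_) (evalAt-++ p q x))
  (sym (ℚ[i].+-assoc (ι a ⊗ x ↑ n) (evalAt p x) (evalAt q x)))

↑-+ : ∀ x m n → x ↑ (m +ℕ n) ≡ x ↑ m ⊗ x ↑ n
↑-+ x zero    n = sym (ℚ[i].*-identityˡ (x ↑ n))
↑-+ x (suc m) n = trans (cong (x ⊗_) (↑-+ x m n)) (sym (ℚ[i].*-assoc x (x ↑ m) (x ↑ n)))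

-- The exponents are a general function `g` because the recursion of `applyUpTo` replaces `g` by
-- `g ∘ suc`.
evalAt-shift : ∀ a m g L x →
  evalAt (applyUpTo (λ i → a , m +ℕ g i) L) x ≡ evalAt (applyUpTo (λ i → 1 , g i) L) x ⊗ (ι a ⊗ x ↑ m)
evalAt-shift a m g zero    x = sym (ℚ[i].zeroˡ (ι a ⊗ x ↑ m))
evalAt-shift a m g (suc L) x = begin
  ι a ⊗ x ↑ (m +ℕ g 0) ⊕ evalAt (applyUpTo (λ i → a , m +ℕ g (suc i)) L) x
    ≡⟨ cong₂ (λ p q → ι a ⊗ p ⊕ q) (↑-+ x m (g 0)) (evalAt-shift a m (g ∘ suc) L x) ⟩
  ι a ⊗ (x ↑ m ⊗ x ↑ g 0) ⊕ r ⊗ (ι a ⊗ x ↑ m)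
    ≡⟨ solve 4 (λ a y z r → a :* (y :* z) :+ r :* (a :* y) := (con (ι 1) :* z :+ r) :* (a :* y)) refl
         (ι a) (x ↑ m) (x ↑ g 0) r ⟩
  (ι 1 ⊗ x ↑ g 0 ⊕ r) ⊗ (ι a ⊗ x ↑ m) ∎
  where
  open ≡-Reasoning
  open ℚ[i]-Solver
  r = evalAt (applyUpTo (λ i → 1 , g (suc i)) L) x

evalAt-A : ∀ M p x → evalAt (A M p) x ≡ evalAt (geom M) x ⊗ evalAt (map deriv p) x
evalAt-A M []            x = sym (ℚ[i].zeroʳ (evalAt (geom M) x))
evalAt-A M ((a , n) ∷ p) x = begin
  evalAt (mulGeom M (deriv (a , n)) ++ A M p) x
    ≡⟨ evalAt-++ (mulGeom M (deriv (a , n))) (A M p) x ⟩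
  evalAt (mulGeom M (deriv (a , n))) x ⊕ evalAt (A M p) x
    ≡⟨ cong₂ _⊕_ (evalAt-shift (a *ℕ n) (n ∸ 1) (λ i → i) M x) (evalAt-A M p x) ⟩
  g ⊗ (ι (a *ℕ n) ⊗ x ↑ (n ∸ 1)) ⊕ g ⊗ evalAt (map deriv p) x
    ≡⟨ ℚ[i].distribˡ g _ _ ⟨
  g ⊗ evalAt (map deriv ((a , n) ∷ p)) x ∎
  where
  open ≡-Reasoning
  g = evalAt (geom M) x

evalAt-A₁ : ∀ p x → evalAt (A 1 p) x ≡ evalAt (map deriv p) x
evalAt-A₁ p x = trans (evalAt-A 1 p x) (ℚ[i].*-identityˡ _)

evalAt-0 : ∀ M p → evalAt p (ι 0) ≡ ι (valueAt0 M 0 p)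
evalAt-0 M []                = refl
evalAt-0 M ((a , zero) ∷ p)  = begin
  ι a ⊗ ι 1 ⊕ evalAt p (ι 0)        ≡⟨ cong₂ _⊕_ (sym (ι-* a 1)) (evalAt-0 M p) ⟩
  ι (a *ℕ 1) ⊕ ι (valueAt0 M 0 p)   ≡⟨ ι-+ (a *ℕ 1) _ ⟨
  ι (a *ℕ 1 +ℕ valueAt0 M 0 p)      ∎
  where open ≡-Reasoning
evalAt-0 M ((a , suc n) ∷ p) = begin
  ι a ⊗ (ι 0 ⊗ ι 0 ↑ n) ⊕ evalAt p (ι 0)
    ≡⟨ cong₂ _⊕_ (solve 2 (λ a y → a :* (con (ι 0) :* y) := a :* con (ι 0)) refl (ι a) (ι 0 ↑ n)) (evalAt-0 M p) ⟩
  ι a ⊗ ι 0 ⊕ ι (valueAt0 M 0 p)    ≡⟨ cong (_⊕ ι (valueAt0 M 0 p)) (ι-* a 0) ⟨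
  ι (a *ℕ 0) ⊕ ι (valueAt0 M 0 p)   ≡⟨ ι-+ (a *ℕ 0) _ ⟨
  ι (a *ℕ 0 +ℕ valueAt0 M 0 p)      ∎
  where
  open ≡-Reasoning
  open ℚ[i]-Solver

at-^ : ∀ z m n → (z ^ m) at n ≡ z at n ↑ m
at-^ z zero    n = refl
at-^ z (suc m) n = cong (z at n ⊗_) (at-^ z m n)

opaque
  -- Opaque, so that the Cauchy sequences behind a value never unfold: `at-eval` is the only access
  -- to it.
  eval : Poly → ℂ → ℂ
  eval p z = ∑ p (λ (a , n) → fromℕ a * z ^ n)

  at-eval : ∀ p z n → eval p z at n ≡ evalAt p (z at n)
  at-eval []            z n = refl
  at-eval ((a , m) ∷ p) z n = cong₂ (λ x y → ι a ⊗ x ⊕ y) (at-^ z m n) (at-eval p z n)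

p≤p+q : ∀ p {q} → 0ℚ ℚ.≤ q → p ℚ.≤ p ℚ.+ q
p≤p+q p 0≤q = ℚₚ.≤-trans (ℚₚ.≤-reflexive (sym (ℚₚ.+-identityʳ p))) (ℚₚ.+-monoʳ-≤ p 0≤q)

p≤∣p∣ : ∀ p → p ℚ.≤ ∣ p ∣
p≤∣p∣ p with ℚₚ.≤-total 0ℚ p
... | inj₁ 0≤p = ℚₚ.≤-reflexive (sym (ℚₚ.0≤p⇒∣p∣≡p 0≤p))
... | inj₂ p≤0 = ℚₚ.≤-trans p≤0 (ℚₚ.0≤∣p∣ p)

-- Take δ = ε / S with S = B + 1 + ε. Then S ≥ ε gives δ ≤ 1, and S ≥ 1 with S ≥ B gives S² ≥ B, so
-- that B δ² ≤ (S δ)² = ε². No square root of B is required.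
small-radius : ∀ B ε → 0ℚ ℚ.≤ B → 0ℚ ℚ.< ε →
               ∃[ δ ] (0ℚ ℚ.< δ × δ ℚ.≤ 1ℚ × B ℚ.* (δ ℚ.* δ) ℚ.≤ ε ℚ.* ε)
small-radius B ε 0≤B 0<ε = δ , 0<δ , δ≤1 , (begin
  B ℚ.* (δ ℚ.* δ)         ≤⟨ *-mono-≤-nonneg 0≤B B≤SS (*-nonneg 0≤δ 0≤δ) ℚₚ.≤-refl ⟩
  S ℚ.* S ℚ.* (δ ℚ.* δ)   ≡⟨ solve 2 (λ s d → s :* s :* (d :* d) := (s :* d) :* (s :* d)) refl S δ ⟩
  S ℚ.* δ ℚ.* (S ℚ.* δ)   ≡⟨ cong₂ ℚ._*_ Sδ≡ε Sδ≡ε ⟩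
  ε ℚ.* ε                 ∎)
  where
  open ℚₚ.≤-Reasoning
  open ℚSolver.+-*-Solver
  S = B ℚ.+ 1ℚ ℚ.+ ε
  0≤ε = ℚₚ.<⇒≤ 0<ε
  1≤S : 1ℚ ℚ.≤ S
  1≤S = ℚₚ.+-mono-≤ (ℚₚ.+-mono-≤ 0≤B (ℚₚ.≤-refl {1ℚ})) 0≤ε
  B≤S : B ℚ.≤ S
  B≤S = ℚₚ.≤-trans (p≤p+q B 0≤1) (p≤p+q (B ℚ.+ 1ℚ) 0≤ε)
  ε≤S : ε ℚ.≤ S
  ε≤S = ℚₚ.≤-trans (p≤p+q ε (+-nonneg 0≤B 0≤1)) (ℚₚ.≤-reflexive (ℚₚ.+-comm ε (B ℚ.+ 1ℚ)))
  instance
    posS : ℚ.Positive S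
    posS = ℚ.positive (ℚₚ.<-≤-trans (ℚₚ.positive⁻¹ 1ℚ) 1≤S)
    S≢0 : ℚ.NonZero S
    S≢0 = ℚₚ.pos⇒nonZero S
    posS⁻¹ : ℚ.Positive (ℚ.1/ S)
    posS⁻¹ = ℚₚ.1/pos⇒pos S
  δ = ε ℚ.* (ℚ.1/ S)
  0<δ : 0ℚ ℚ.< δ
  0<δ = ℚₚ.positive⁻¹ δ {{ℚₚ.pos*pos⇒pos ε {{ℚ.positive 0<ε}} (ℚ.1/ S)}}
  0≤δ = ℚₚ.<⇒≤ 0<δ
  δ≤1 : δ ℚ.≤ 1ℚ
  δ≤1 = ℚₚ.≤-trans (ℚₚ.*-monoʳ-≤-nonNeg (ℚ.1/ S) {{ℚₚ.pos⇒nonNeg (ℚ.1/ S)}} ε≤S) (ℚₚ.≤-reflexive (ℚₚ.*-inverseʳ S))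
  B≤SS : B ℚ.≤ S ℚ.* S
  B≤SS = ℚₚ.≤-trans (ℚₚ.≤-reflexive (sym (ℚₚ.*-identityʳ B))) (*-mono-≤-nonneg 0≤B B≤S 0≤1 1≤S)
  Sδ≡ε : S ℚ.* δ ≡ ε
  Sδ≡ε = begin-equality
    S ℚ.* (ε ℚ.* (ℚ.1/ S))   ≡⟨ solve 3 (λ s e i → s :* (e :* i) := e :* (s :* i)) refl S ε (ℚ.1/ S) ⟩
    ε ℚ.* (S ℚ.* (ℚ.1/ S))   ≡⟨ cong (ε ℚ.*_) (ℚₚ.*-inverseʳ S) ⟩
    ε ℚ.* 1ℚ                 ≡⟨ ℚₚ.*-identityʳ ε ⟩
    ε                        ∎

remainder-small : ∀ f f′ → QuadraticRemainder f f′ → ∀ R → 0ℚ ℚ.≤ R → ∀ ε → 0ℚ ℚ.< ε →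
  ∃[ δ ] (0ℚ ℚ.< δ × (∀ x h → norm x ℚ.≤ R → norm h ℚ.≤ δ ℚ.* δ →
    norm (remainder f f′ x h) ℚ.≤ ε ℚ.* ε ℚ.* norm h))
remainder-small f f′ quad R 0≤R ε 0<ε =
  let B , 0≤B , bound = quad R 0≤R
      δ , 0<δ , δ≤1 , Bδδ≤εε = small-radius B ε 0≤B 0<ε
      0≤δ = ℚₚ.<⇒≤ 0<δ
  in δ , 0<δ , λ x h x≤R h≤δδ → begin
    norm (remainder f f′ x h)   ≤⟨ bound x h x≤R (ℚₚ.≤-trans h≤δδ (*-mono-≤-nonneg 0≤δ δ≤1 0≤δ δ≤1)) ⟩
    B ℚ.* (norm h ℚ.* norm h)   ≡⟨ ℚₚ.*-assoc B (norm h) (norm h) ⟨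
    B ℚ.* norm h ℚ.* norm h
      ≤⟨ ℚₚ.*-monoʳ-≤-nonNeg (norm h) {{ℚ.nonNegative (norm≥0 h)}}
           (ℚₚ.≤-trans (*-mono-≤-nonneg 0≤B (ℚₚ.≤-refl {B}) (norm≥0 h) h≤δδ) Bδδ≤εε) ⟩
    ε ℚ.* ε ℚ.* norm h           ∎
  where open ℚₚ.≤-Reasoning

∣∣²-≤ʳ : ∀ N ε (a b d h : ℂ) →
  (∀ n → N ≤ n → norm (a at n ⊖ b at n ⊖ d at n ⊗ h at n) ℚ.≤ ε ℚ.* ε ℚ.* norm (h at n)) →
  ∣ a - b - d * h ∣² ≤ʳ fromℚ (ε ℚ.* ε) *ʳ ∣ h ∣²
∣∣²-≤ʳ N ε a b d h bound ε′ 0<ε′ = N , λ n N≤n →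
  ℚₚ.≤-trans (bound n N≤n) (p≤p+q (ε ℚ.* ε ℚ.* norm (h at n)) (ℚₚ.<⇒≤ 0<ε′))

norm-bounded : ∀ z → ∃[ R ] (0ℚ ℚ.≤ R × ∃[ N ] (∀ n → N ≤ n → norm (z at n) ℚ.≤ R))
norm-bounded z =
  let R , posR , N , bound = cauchy-bounded {seq ∣ z ∣²} (cauchy ∣ z ∣²)
  in R , ℚₚ.<⇒≤ (ℚₚ.positive⁻¹ R {{posR}}) , N , λ n N≤n → ℚₚ.≤-trans (p≤∣p∣ (norm (z at n))) (bound n N≤n)

eval-isDerivative : ∀ {D : Region} p → IsDerivative {D} (λ z _ → eval p z) (λ z _ → eval (A 1 p) z)
eval-isDerivative p z _ ε 0<ε =
  let R , 0≤R , N₀ , z≤R = norm-bounded z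
      δ , 0<δ , small = remainder-small (evalAt p) (evalAt (map deriv p)) (quadratic-evalAt p) R 0≤R ε 0<ε
  -- Membership of w in the disc provides a margin η and an index `N₁` beyond which |w - z|² + η ≤
  -- δ² termwise. From `N₀` on, the approximations of z stay in the ball of squared radius R.
  in δ , 0<δ , λ w _ (η , 0<η , N₁ , near) →
    ∣∣²-≤ʳ (N₀ ⊔ N₁) ε (eval p w) (eval p z) (eval (A 1 p) z) (w - z) λ n N≤n →
      let x = z at n
          h = w at n ⊖ z at n
      in ℚₚ.≤-trans
        (ℚₚ.≤-reflexive (cong norm (cong₂ _⊖_
             (cong₂ _⊖_ (trans (at-eval p w n) (cong (evalAt p) (y≡x+h x (w at n)))) (at-eval p z n))
             (cong (_⊗ h) (trans (at-eval (A 1 p) z n) (evalAt-A₁ p x))))))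
        (small x h (z≤R n (ℕₚ.m⊔n≤o⇒m≤o N₀ N₁ N≤n))
          (ℚₚ.≤-trans (p≤p+q (norm h) (ℚₚ.<⇒≤ 0<η)) (near n (ℕₚ.m⊔n≤o⇒n≤o N₀ N₁ N≤n))))
  where
  y≡x+h : ∀ x y → y ≡ x ⊕ (y ⊖ x)
  y≡x+h = solve 2 (λ x y → y := x :+ (y :- x)) refl
    where open ℚ[i]-Solver

-- Equality of complex numbers

infix 4 _≐_

-- Finer than `_≈_`, and preserved by all operations through mere congruence. Algebraic
-- rearrangements are made up to `_≐_`, even around the unknown coefficients, so few limit arguments
-- about `_≈_` remain.
_≐_ : ℂ → ℂ → Set
z ≐ w = ∀ n → z at n ≡ w at n

≐⇒≈ : ∀ z w → z ≐ w → z ≈ w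
≐⇒≈ z w eq = close (seq (re z)) (seq (re w)) (cong proj₁ ∘ eq) , close (seq (im z)) (seq (im w)) (cong proj₂ ∘ eq)
  where
  close : ∀ (x y : ℕ → ℚ) → (∀ n → x n ≡ y n) → ∀ ε → 0ℚ ℚ.< ε → ∃[ N ] (∀ n → N ≤ n → ∣ x n ℚ.- y n ∣ ℚ.≤ ε)
  close x y eq ε 0<ε = 0 , λ n _ → subst (λ t → ∣ t ∣ ℚ.≤ ε)
    (sym (trans (cong (ℚ._- y n) (eq n)) (ℚₚ.+-inverseʳ (y n)))) (ℚₚ.<⇒≤ 0<ε)

≈-resp-≐ : ∀ z z′ w w′ → z ≐ z′ → w ≐ w′ → z ≈ w → z′ ≈ w′
≈-resp-≐ z z′ w w′ z≐z′ w≐w′ (p , q) =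
  close (re z) (re z′) (re w) (re w′) (cong proj₁ ∘ z≐z′) (cong proj₁ ∘ w≐w′) p ,
  close (im z) (im z′) (im w) (im w′) (cong proj₂ ∘ z≐z′) (cong proj₂ ∘ w≐w′) q
  where
  close : ∀ x x′ y y′ → (∀ n → seq x n ≡ seq x′ n) → (∀ n → seq y n ≡ seq y′ n) → x ≃ y → x′ ≃ y′
  close x x′ y y′ xx′ yy′ x≃y ε 0<ε with x≃y ε 0<ε
  ... | N , h = N , λ n N≤n → subst₂ (λ a b → ∣ a ℚ.- b ∣ ℚ.≤ ε) (xx′ n) (yy′ n) (h n N≤n)

≈-sym : ∀ z w → z ≈ w → w ≈ z
≈-sym z w (p , q) = flip (re z) (re w) p , flip (im z) (im w) q
  where
  flip : ∀ x y → x ≃ y → y ≃ x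
  flip x y x≃y ε 0<ε with x≃y ε 0<ε
  ... | N , h = N , λ n N≤n → subst (ℚ._≤ ε) (swap (seq x n) (seq y n)) (h n N≤n)
    where
    open ℚSolver.+-*-Solver
    swap : ∀ a b → ∣ a ℚ.- b ∣ ≡ ∣ b ℚ.- a ∣
    swap a b = trans (sym (ℚₚ.∣-p∣≡∣p∣ (a ℚ.- b))) (cong ∣_∣ (solve 2 (λ a b → :- (a :- b) := b :- a) refl a b))

≃-+ : ∀ x x′ y y′ → x ≃ x′ → y ≃ y′ → x +ʳ y ≃ x′ +ʳ y′
≃-+ x x′ y y′ p q ε 0<ε with p (½ ℚ.* ε) 0<½ε | q (½ ℚ.* ε) 0<½ε
  where
  0<½ε : 0ℚ ℚ.< ½ ℚ.* ε
  0<½ε = ℚₚ.positive⁻¹ _ {{ℚₚ.pos*pos⇒pos ½ ε {{ℚ.positive 0<ε}}}}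
... | M , hx | N , hy = M ⊔ N , λ n M⊔N≤n → begin
  ∣ seq x n ℚ.+ seq y n ℚ.- (seq x′ n ℚ.+ seq y′ n) ∣
    ≡⟨ cong ∣_∣ (solve 4 (λ a b c d → a :+ c :- (b :+ d) := (a :- b) :+ (c :- d)) refl
         (seq x n) (seq x′ n) (seq y n) (seq y′ n)) ⟩
  ∣ (seq x n ℚ.- seq x′ n) ℚ.+ (seq y n ℚ.- seq y′ n) ∣
    ≤⟨ ℚₚ.∣p+q∣≤∣p∣+∣q∣ (seq x n ℚ.- seq x′ n) (seq y n ℚ.- seq y′ n) ⟩
  ∣ seq x n ℚ.- seq x′ n ∣ ℚ.+ ∣ seq y n ℚ.- seq y′ n ∣
    ≤⟨ ℚₚ.+-mono-≤ (hx n (ℕₚ.m⊔n≤o⇒m≤o M N M⊔N≤n)) (hy n (ℕₚ.m⊔n≤o⇒n≤o M N M⊔N≤n)) ⟩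
  ½ ℚ.* ε ℚ.+ ½ ℚ.* ε
    ≡⟨ solve 1 (λ e → con ½ :* e :+ con ½ :* e := e) refl ε ⟩
  ε ∎
  where
  open ℚₚ.≤-Reasoning
  open ℚSolver.+-*-Solver

Null : ℂ → Set
Null z = z ≈ fromℕ 0

null-+ : ∀ z w → Null z → Null w → Null (z + w)
null-+ z w (p , q) (p′ , q′) = ≈-resp-≐ (z + w) (z + w) (fromℕ 0 + fromℕ 0) (fromℕ 0) (λ _ → refl) (λ _ → refl)
  ( ≃-+ (re z) (re (fromℕ 0)) (re w) (re (fromℕ 0)) p p′
  , ≃-+ (im z) (im (fromℕ 0)) (im w) (im (fromℕ 0)) q q′)

null-∑ : ∀ {I : Set} (is : List I) (t : I → ℂ) → All (λ i → Null (t i)) is → Null (∑ is t)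
null-∑ []       t []             = ≐⇒≈ (fromℕ 0) (fromℕ 0) (λ _ → refl)
null-∑ (i ∷ is) t (null ∷ nulls) = null-+ (t i) (∑ is t) null (null-∑ is t nulls)

-- A natural multiple is a repeated sum, so `null-+` suffices and no estimate for products of Cauchy
-- sequences enters.
null-natural* : ∀ m z → Null z → Null (fromℕ m * z)
null-natural* zero    z _    = ≐⇒≈ (fromℕ 0 * z) (fromℕ 0) (λ n → ℚ[i].zeroˡ (z at n))
null-natural* (suc m) z null = ≈-resp-≐ (z + fromℕ m * z) (fromℕ (suc m) * z) (fromℕ 0) (fromℕ 0) eq (λ _ → refl)
  (null-+ (z) (fromℕ m * z) null (null-natural* m z null))
  where
  open ℚ[i]-Solver
  eq : z + fromℕ m * z ≐ fromℕ (suc m) * z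
  eq n = trans (solve 2 (λ z m → z :+ m :* z := (con (ι 1) :+ m) :* z) refl (z at n) (ι m))
               (cong (_⊗ z at n) (sym (ι-suc m)))

-- Multiplication by a positive natural number does not shrink distances, so the index that serves ε
-- for the products also serves ε for the factors.
*natural-cancel : ∀ m .{{_ : NonZero m}} z w → z * fromℕ m ≈ w * fromℕ m → z ≈ w
*natural-cancel (suc m) z w (p , q) =
  close (re z) (re w) (re (z * fromℕ (suc m))) (re (w * fromℕ (suc m)))
    (λ n → solve 5 (λ a b c d k → (a :* k :- b :* con 0ℚ) :- (c :* k :- d :* con 0ℚ) := (a :- c) :* k) refl
             (seq (re z) n) (seq (im z) n) (seq (re w) n) (seq (im w) n) (natℚ (suc m))) p ,
  close (im z) (im w) (im (z * fromℕ (suc m))) (im (w * fromℕ (suc m)))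
    (λ n → solve 5 (λ a b c d k → (a :* con 0ℚ :+ b :* k) :- (c :* con 0ℚ :+ d :* k) := (b :- d) :* k) refl
             (seq (re z) n) (seq (im z) n) (seq (re w) n) (seq (im w) n) (natℚ (suc m))) q
  where
  open ℚSolver.+-*-Solver using (solve; _:*_; _:+_; _:-_; _:=_; con)
  natℚ≥0 : ∀ m → 0ℚ ℚ.≤ natℚ m
  natℚ≥0 zero    = ℚₚ.≤-refl
  natℚ≥0 (suc m) = subst (0ℚ ℚ.≤_) (sym (natℚ-suc m)) (+-nonneg 0≤1 (natℚ≥0 m))
  natℚ≥1 : 1ℚ ℚ.≤ natℚ (suc m)
  natℚ≥1 = subst (1ℚ ℚ.≤_) (sym (natℚ-suc m)) (ℚₚ.+-monoʳ-≤ 1ℚ (natℚ≥0 m))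
  close : ∀ x y x′ y′ → (∀ n → seq x′ n ℚ.- seq y′ n ≡ (seq x n ℚ.- seq y n) ℚ.* natℚ (suc m)) → x′ ≃ y′ → x ≃ y
  close x y x′ y′ scaled x′≃y′ ε 0<ε with x′≃y′ ε 0<ε
  ... | N , h = N , λ n N≤n → let d = seq x n ℚ.- seq y n in begin
    ∣ d ∣                        ≡⟨ ℚₚ.*-identityʳ ∣ d ∣ ⟨
    ∣ d ∣ ℚ.* 1ℚ                 ≤⟨ ℚₚ.*-monoˡ-≤-nonNeg ∣ d ∣ {{ℚₚ.∣-∣-nonNeg d}} natℚ≥1 ⟩
    ∣ d ∣ ℚ.* natℚ (suc m)       ≡⟨ cong (∣ d ∣ ℚ.*_) (ℚₚ.0≤p⇒∣p∣≡p (natℚ≥0 (suc m))) ⟨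
    ∣ d ∣ ℚ.* ∣ natℚ (suc m) ∣   ≡⟨ ℚₚ.∣p*q∣≡∣p∣*∣q∣ d (natℚ (suc m)) ⟨
    ∣ d ℚ.* natℚ (suc m) ∣       ≡⟨ cong ∣_∣ (scaled n) ⟨
    ∣ seq x′ n ℚ.- seq y′ n ∣    ≤⟨ h n N≤n ⟩
    ε                            ∎
    where open ℚₚ.≤-Reasoning

-- Termwise equality of sums, products and powers

∑-cong : ∀ {I : Set} (is : List I) {t t′ : I → ℂ} → (∀ i → t i ≐ t′ i) → ∑ is t ≐ ∑ is t′
∑-cong []       eq n = refl
∑-cong (i ∷ is) eq n = cong₂ _⊕_ (eq i n) (∑-cong is eq n)

∏-cong : ∀ {I : Set} (is : List I) {t t′ : I → ℂ} → (∀ i → t i ≐ t′ i) → ∏ is t ≐ ∏ is t′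
∏-cong []       eq n = refl
∏-cong (i ∷ is) eq n = cong₂ _⊗_ (eq i n) (∏-cong is eq n)

∑-zero : ∀ (g : ℕ → ℕ) L {t : ℕ → ℂ} → (∀ i → i < L → t (g i) ≐ fromℕ 0) → ∑ (applyUpTo g L) t ≐ fromℕ 0
∑-zero g zero    h n = refl
∑-zero g (suc L) h n = cong₂ _⊕_ (h 0 z<s n) (∑-zero (g ∘ suc) L (λ i → h (suc i) ∘ s<s) n)

∑-pick : ∀ (g : ℕ → ℕ) L {t : ℕ → ℂ} i → i < L → (∀ j → j < L → j ≢ i → t (g j) ≐ fromℕ 0) →
         ∑ (applyUpTo g L) t ≐ t (g i)
∑-pick g (suc L) {t} zero _ h n = trans
  (cong (t (g 0) at n ⊕_) (∑-zero (g ∘ suc) L {t} (λ j j<L → h (suc j) (s<s j<L) (λ ())) n))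
  (ℚ[i].+-identityʳ (t (g 0) at n))
∑-pick g (suc L) {t} (suc i) (s<s i<L) h n = trans
  (cong₂ _⊕_ (h 0 z<s (λ ()) n)
    (∑-pick (g ∘ suc) L {t} i i<L (λ j j<L j≢i → h (suc j) (s<s j<L) (λ e → j≢i (ℕₚ.suc-injective e))) n))
  (ℚ[i].+-identityˡ (t (g (suc i)) at n))

^-cong : ∀ {z w} m → z ≐ w → z ^ m ≐ w ^ m
^-cong zero    eq n = refl
^-cong (suc m) eq n = cong₂ _⊗_ (eq n) (^-cong m eq n)

1^m : ∀ m → fromℕ 1 ^ m ≐ fromℕ 1
1^m zero    n = refl
1^m (suc m) n = trans (cong (ι 1 ⊗_) (1^m m n)) (ℚ[i].*-identityˡ (ι 1))

^-natural : ∀ a m → fromℕ a ^ m ≐ fromℕ (a ℕ.^ m)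
^-natural a zero    n = refl
^-natural a (suc m) n = trans (cong (ι a ⊗_) (^-natural a m n)) (sym (ι-* a (a ℕ.^ m)))

∏-natural : ∀ {I : Set} (is : List I) {t : I → ℂ} → (∀ i → ∃[ m ] (t i ≐ fromℕ m)) → ∃[ m ] (∏ is t ≐ fromℕ m)
∏-natural []       h = 1 , λ _ → refl
∏-natural (i ∷ is) h =
  let m , eq = h i
      m′ , eq′ = ∏-natural is h
  in m *ℕ m′ , λ n → trans (cong₂ _⊗_ (eq n) (eq′ n)) (sym (ι-* m m′))

∑∑-cong : ∀ s {t t′ : ℕ → Vec ℕ s → ℂ} → (∀ m α → t m α ≐ t′ m α) → ∑∑ s t ≐ ∑∑ s t′
∑∑-cong zero      eq n = refl
∑∑-cong s@(suc _) eq n = ∑-cong [1‥ s ] (λ m → ∑-cong (indices s m) (eq m)) n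

-- Entries of a filtered list satisfy the filter's predicate; this recovers the two conditions on α
-- under which `TopZero` speaks.
null-∑∑ : ∀ r (t : ℕ → Vec ℕ (suc r) → ℂ) →
  (∀ m α → 1 ≤ m → m ≤ suc r → Vec.sum α ≡ m → weight α ≡ suc r → Null (t m α)) → Null (∑∑ (suc r) t)
null-∑∑ r t null = null-∑ [1‥ s ] (λ m → ∑ (indices s m) (t m)) (applyUpTo⁺₁ suc s λ {i} i<s →
    null-∑ (indices s (suc i)) (t (suc i)) (All.map
      (λ {α} (sum≡m , weight≡s) → null (suc i) α (s≤s z≤n) i<s sum≡m weight≡s)
      (all-filter _ (vectors≤ (suc i) s))))
  where s = suc r

-- The weights are natural numbers, so `null-natural*` applies to weighted null coefficients.
factorials-natural : ∀ {s} (α : Vec ℕ s) → ∃[ m ] (∏ (allFin s) (λ i → fromℕ (suc (toℕ i) !) ^ lookup α i) ≐ fromℕ m)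
factorials-natural {s} α = ∏-natural (allFin s)
  (λ i → (suc (toℕ i) !) ℕ.^ lookup α i , ^-natural (suc (toℕ i) !) (lookup α i))

-- The expansion at 0

Plane : Region
Plane _ = ⊤

polynomial-isEntire : ∀ p → IsEntireOrMeromorphic {Plane} (λ z _ → eval p z)
polynomial-isEntire p = inj₁ ((λ _ → tt) , (λ _ _ → 1ℚ , ℚₚ.positive⁻¹ 1ℚ , λ _ _ → tt) ,
  (λ z _ → eval (A 1 p) z) , eval-isDerivative p)

polynomial-derivatives : ∀ p → AreDerivatives {Plane} (λ z _ → eval p z) (λ n z _ → eval ((1 ^A n) p) z)
polynomial-derivatives p = (λ z _ → ≐⇒≈ (eval p z) (eval p z) (λ _ → refl)) , λ n → eval-isDerivative ((1 ^A n) p)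

-- The required derivative of each iterate is its formal one, and by `evalAt-A` multiplying it by u
-- gives the next iterate.
polynomial-iterates : ∀ M p →
  AreIterates {Plane} {Plane} (λ z _ → eval (geom M) z) (λ z _ → eval p z) (λ n z _ → eval ((M ^A n) p) z)
polynomial-iterates M p = (λ z _ _ → ≐⇒≈ (eval p z) (eval p z) (λ _ → refl)) , λ n →
  (λ z _ → eval (A 1 ((M ^A n) p)) z) , eval-isDerivative ((M ^A n) p) , λ z _ _ →
  ≐⇒≈ (eval (A M ((M ^A n) p)) z) (eval (geom M) z * eval (A 1 ((M ^A n) p)) z) (step ((M ^A n) p) z)
  where
  open ≡-Reasoning
  step : ∀ q z → eval (A M q) z ≐ eval (geom M) z * eval (A 1 q) z
  step q z n = begin
    eval (A M q) z at n       ≡⟨ at-eval (A M q) z n ⟩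
    evalAt (A M q) (z at n)   ≡⟨ evalAt-A M q (z at n) ⟩
    evalAt (geom M) (z at n) ⊗ evalAt (map deriv q) (z at n)
      ≡⟨ cong₂ _⊗_ (at-eval (geom M) z n) (trans (at-eval (A 1 q) z n) (evalAt-A₁ q (z at n))) ⟨
    eval (geom M) z at n ⊗ eval (A 1 q) z at n           ∎

iterate-at-0 : ∀ M k p → eval ((M ^A k) p) (fromℕ 0) ≐ fromℕ (valueAt0 M k p)
iterate-at-0 M k p n = begin
  eval ((M ^A k) p) (fromℕ 0) at n   ≡⟨ at-eval ((M ^A k) p) (fromℕ 0) n ⟩
  evalAt ((M ^A k) p) (ι 0)          ≡⟨ evalAt-0 M ((M ^A k) p) ⟩
  ι (valueAt0 M 0 ((M ^A k) p))      ≡⟨ cong ι (valueAt0-^A M k p) ⟩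
  ι (valueAt0 M k p)                 ∎
  where open ≡-Reasoning

valueAt0-monomial : ∀ M k j → valueAt0 M k ((1 , j) ∷ []) ≡ monomialAt0 M k j
valueAt0-monomial M k j = trans (ℕₚ.+-identityʳ _) (ℕₚ.*-identityˡ (monomialAt0 M k j))

geom-derivatives-at-0 : ∀ M i → i < M → eval ((1 ^A i) (geom M)) (fromℕ 0) ≐ fromℕ (i !)
geom-derivatives-at-0 M i i<M n = trans (iterate-at-0 1 i (geom M) n) (cong ι (valueAt0-geom M i i<M))

monomial-derivatives-at-0 : ∀ i j → i ≢ j → eval ((1 ^A i) ((1 , j) ∷ [])) (fromℕ 0) ≐ fromℕ 0
monomial-derivatives-at-0 i j i≢j n =
  trans (iterate-at-0 1 i ((1 , j) ∷ []) n) (cong ι (trans (valueAt0-monomial 1 i j) (monomialAt0₁-off i j i≢j)))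

monomial-derivative-at-0 : ∀ j → eval ((1 ^A j) ((1 , j) ∷ [])) (fromℕ 0) ≐ fromℕ (j !)
monomial-derivative-at-0 j n =
  trans (iterate-at-0 1 j ((1 , j) ∷ []) n) (cong ι (trans (valueAt0-monomial 1 j j) (monomialAt0₁-diag j)))

top-null : ∀ c → TopZero c → ∀ r →
  Null (∑∑ (suc r) (λ m α → ∏ (allFin (suc r)) (λ i → fromℕ (suc (toℕ i) !) ^ lookup α i) * c (suc r) (suc r) m α))
top-null c top r =
  null-∑∑ r (λ m α → ∏ (allFin (suc r)) (λ i → fromℕ (suc (toℕ i) !) ^ lookup α i) * c (suc r) (suc r) m α)
    λ m α 1≤m m≤s sum≡m weight≡s →
      null-*ˡ (∏ (allFin (suc r)) (λ i → fromℕ (suc (toℕ i) !) ^ lookup α i)) (c (suc r) (suc r) m α)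
        (factorials-natural {suc r} α) (top (suc r) m α (s≤s z≤n) 1≤m m≤s sum≡m weight≡s)
  where
  null-*ˡ : ∀ y z → ∃[ m ] (y ≐ fromℕ m) → Null z → Null (y * z)
  null-*ˡ y z (m , y≐m) null = ≈-resp-≐ (fromℕ m * z) (y * z) (fromℕ 0) (fromℕ 0)
    (λ n → cong (_⊗ z at n) (sym (y≐m n))) (λ _ → refl) (null-natural* m z null)

-- Read v as uᵏ, T s as the coefficient of the derivative of order k - s, and F i as the i-th derivative of f at 0.
expansion-collapse : ∀ k j r (J : ℕ) (F T : ℕ → ℂ) (v : ℂ) → 1 ≤ j → j +ℕ suc r ≡ k →
  (∀ i → i ≢ j → F i ≐ fromℕ 0) → F j ≐ fromℕ J →
  v * F k + (∑ [1‥ k ∸ 1 ] λ s → T s * F (k ∸ s)) ≐ T (suc r) * fromℕ J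
expansion-collapse k j r J F T v 1≤j refl F≐0 Fj≐J n = begin
  v at n ⊗ F k at n ⊕ (∑ [1‥ k ∸ 1 ] λ s → T s * F (k ∸ s)) at n
    ≡⟨ cong₂ (λ x y → v at n ⊗ x ⊕ y) (F≐0 k (ℕₚ.m+1+n≢m j) n)
         (∑-pick suc (k ∸ 1) {λ s → T s * F (k ∸ s)} r r<k∸1
           (λ i i<k-1 i≢r n → trans (cong (T (suc i) at n ⊗_) (F≐0 (k ∸ suc i) (k∸[1+i]≢j i i<k-1 i≢r) n))
                                    (ℚ[i].zeroʳ (T (suc i) at n))) n) ⟩
  v at n ⊗ ι 0 ⊕ T (suc r) at n ⊗ F (k ∸ suc r) at n
    ≡⟨ cong₂ (λ x y → x ⊕ T (suc r) at n ⊗ y) (ℚ[i].zeroʳ (v at n))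
         (trans (cong (λ i → F i at n) (ℕₚ.m+n∸n≡m j (suc r))) (Fj≐J n)) ⟩
  ι 0 ⊕ T (suc r) at n ⊗ ι J
    ≡⟨ ℚ[i].+-identityˡ (T (suc r) at n ⊗ ι J) ⟩
  T (suc r) at n ⊗ ι J ∎
  where
  open ≡-Reasoning
  k∸[1+i]≢j : ∀ i → i < k ∸ 1 → i ≢ r → k ∸ suc i ≢ j
  k∸[1+i]≢j i i<k-1 i≢r e = i≢r (ℕₚ.suc-injective (ℕₚ.+-cancelˡ-≡ j (suc i) (suc r)
    (trans (cong (_+ℕ suc i) (sym e)) (ℕₚ.m∸n+n≡m (ℕₚ.≤-trans i<k-1 (ℕₚ.m∸n≤m k 1))))))
  r<k∸1 : r < k ∸ 1
  r<k∸1 = ℕₚ.≤-trans (ℕₚ.+-monoˡ-≤ r 1≤j) (ℕₚ.≤-reflexive (cong (_∸ 1) (sym (ℕₚ.+-suc j r))))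

-- Since u is 1 at the point, the power of u disappears whatever its exponent; the product involves
-- only derivatives of order at most s.
expansion-term : ∀ s e (α : Vec ℕ s) (u : ℂ) (U : ℕ → ℂ) (w : ℂ) →
  u ≐ fromℕ 1 → (∀ i → i ≤ s → U i ≐ fromℕ (i !)) →
  u ^ e * (w * ∏ (allFin s) λ i → U (suc (toℕ i)) ^ lookup α i)
    ≐ ∏ (allFin s) (λ i → fromℕ (suc (toℕ i) !) ^ lookup α i) * w
expansion-term s e α u U w u≐1 U≐! n = begin
  (u ^ e) at n ⊗ (w at n ⊗ (∏ (allFin s) λ i → U (suc (toℕ i)) ^ lookup α i) at n)
    ≡⟨ cong₂ (λ x y → x ⊗ (w at n ⊗ y))
         (trans (^-cong {u} {fromℕ 1} e u≐1 n) (1^m e n))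
         (∏-cong (allFin s)
           (λ i → ^-cong {U (suc (toℕ i))} {fromℕ (suc (toℕ i) !)} (lookup α i) (U≐! (suc (toℕ i)) (toℕ<n i))) n) ⟩
  ι 1 ⊗ (w at n ⊗ P at n)   ≡⟨ ℚ[i].*-identityˡ (w at n ⊗ P at n) ⟩
  w at n ⊗ P at n           ≡⟨ ℚ[i].*-comm (w at n) (P at n) ⟩
  P at n ⊗ w at n           ∎
  where
  open ≡-Reasoning
  P = ∏ (allFin s) (λ i → fromℕ (suc (toℕ i) !) ^ lookup α i)

cancel-factor : ∀ {x} a m .{{_ : NonZero m}} z → x ≡ a *ℕ m → fromℕ x ≈ z * fromℕ m → z ≈ fromℕ a
cancel-factor a m z refl eq = ≈-sym (fromℕ a) z (*natural-cancel m (fromℕ a) z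
  (≈-resp-≐ (fromℕ (a *ℕ m)) (fromℕ a * fromℕ m) (z * fromℕ m) (z * fromℕ m) (λ n → ι-* a m) (λ _ → refl) eq))

monomialAt0-value : ∀ k j s → j +ℕ s ≡ k → monomialAt0 (suc k) k j ≡ [2 s -1]!! *ℕ ((k +ℕ s ∸ 1) C (2 *ℕ s)) *ℕ j !
monomialAt0-value k j s refl = begin
  monomialAt0 (suc k) k j                            ≡⟨ monomialAt0-closed (suc k) k j s (s≤s (ℕₚ.m≤n+m s j)) refl ⟩
  j ! *ℕ ([2 s -1]!! *ℕ ((k +ℕ s ∸ 1) C (s +ℕ s)))   ≡⟨ ℕₚ.*-comm (j !) _ ⟩
  [2 s -1]!! *ℕ ((k +ℕ s ∸ 1) C (s +ℕ s)) *ℕ j !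
    ≡⟨ cong (λ t → [2 s -1]!! *ℕ ((k +ℕ s ∸ 1) C (s +ℕ t)) *ℕ j !) (ℕₚ.+-identityʳ s) ⟨
  [2 s -1]!! *ℕ ((k +ℕ s ∸ 1) C (2 *ℕ s)) *ℕ j !        ∎
  where open ≡-Reasoning

top-value : ∀ s → 1 ≤ s → [2 s -1]!! *ℕ ((s +ℕ s ∸ 1) C (2 *ℕ s)) ≡ 0
top-value s@(suc r) _ = trans (cong ([2 s -1]!! ℕ.*_) (k>n⇒nCk≡0 {s +ℕ s ∸ 1} {2 *ℕ s}
  (ℕₚ.≤-reflexive (cong (s ℕ.+_) (sym (ℕₚ.+-identityʳ s)))))) (ℕₚ.*-zeroʳ [2 s -1]!!)

≈fromℕ-resp-≡ : ∀ z {a a′} → a ≡ a′ → z ≈ fromℕ a → z ≈ fromℕ a′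
≈fromℕ-resp-≡ z refl eq = eq

-- Only values at one point enter, which separates the collapse of the expansion from the
-- computations with polynomials. The condition `1 ≤ j` places `suc r` among 1, ..., k - 1, where
-- the expansion has a term.
expansion-at : ∀ c → Expansion c → ∀ k j r a → 1 ≤ j → j +ℕ suc r ≡ k →
  ∀ {D E : Region} (u : FunctionOn D) (f : FunctionOn E) → IsEntireOrMeromorphic u → IsEntireOrMeromorphic f →
  ∀ U F G → AreDerivatives u U → AreDerivatives f F → AreIterates u f G → ∀ z (d : D z) (e : E z) →
  u z d ≐ fromℕ 1 → (∀ i → i ≤ suc r → U i z d ≐ fromℕ (i !)) →
  (∀ i → i ≢ j → F i z e ≐ fromℕ 0) → F j z e ≐ fromℕ (j !) → G k z (d , e) ≐ fromℕ a →
  fromℕ a ≈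
    ∑∑ (suc r) (λ m α → ∏ (allFin (suc r)) (λ i → fromℕ (suc (toℕ i) !) ^ lookup α i) * c k (suc r) m α) * fromℕ (j !)
expansion-at c expansion k j r a 1≤j j+s≡k u f u-mero f-mero U F G uU fF ufG z d e u≐1 U≐! F≐0 Fj≐j! G≐a =
  ≈-resp-≐ (G k z (d , e)) (fromℕ a)
    (u z d ^ k * F k z e + ∑ [1‥ k ∸ 1 ] λ s → ∑∑ s
      (λ m α → u z d ^ (k ∸ m) * (c k s m α * ∏ (allFin s) λ i → U (suc (toℕ i)) z d ^ lookup α i)) * F (k ∸ s) z e)
    (∑∑ (suc r) (λ m α → ∏ (allFin (suc r)) (λ i → fromℕ (suc (toℕ i) !) ^ lookup α i) * c k (suc r) m α) * fromℕ (j !))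
    G≐a
    (λ n → trans
      (expansion-collapse k j r (j !) (λ i → F i z e)
        (λ s → ∑∑ s (λ m α → u z d ^ (k ∸ m) * (c k s m α * ∏ (allFin s) λ i → U (suc (toℕ i)) z d ^ lookup α i)))
        (u z d ^ k) 1≤j j+s≡k F≐0 Fj≐j! n)
      (cong (_⊗ ι (j !)) (∑∑-cong (suc r)
        {λ m α → u z d ^ (k ∸ m) * (c k (suc r) m α * ∏ (allFin (suc r)) λ i → U (suc (toℕ i)) z d ^ lookup α i)}
        {λ m α → ∏ (allFin (suc r)) (λ i → fromℕ (suc (toℕ i) !) ^ lookup α i) * c k (suc r) m α}
        (λ m α → expansion-term (suc r) (k ∸ m) α (u z d) (λ i → U i z d) (c k (suc r) m α) u≐1 U≐!) n)))
    (expansion k 1≤k u f u-mero f-mero U F G uU fF ufG z d e)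
  where
  1≤k : 1 ≤ k
  1≤k = ℕₚ.≤-trans 1≤j (ℕₚ.≤-trans (ℕₚ.m≤m+n j (suc r)) (ℕₚ.≤-reflexive j+s≡k))

weightedSum*j! : ∀ c → Expansion c → ∀ k j r → 1 ≤ j → j +ℕ suc r ≡ k →
  fromℕ (monomialAt0 (suc k) k j) ≈
    ∑∑ (suc r) (λ m α → ∏ (allFin (suc r)) (λ i → fromℕ (suc (toℕ i) !) ^ lookup α i) * c k (suc r) m α) * fromℕ (j !)
weightedSum*j! c expansion k j r 1≤j j+s≡k =
  expansion-at c expansion k j r (monomialAt0 (suc k) k j) 1≤j j+s≡k {Plane} {Plane}
    (λ z _ → eval (geom (suc k)) z) (λ z _ → eval ((1 , j) ∷ []) z)
    (polynomial-isEntire (geom (suc k))) (polynomial-isEntire ((1 , j) ∷ []))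
    (λ n z _ → eval ((1 ^A n) (geom (suc k))) z) (λ n z _ → eval ((1 ^A n) ((1 , j) ∷ [])) z)
    (λ n z _ → eval ((suc k ^A n) ((1 , j) ∷ [])) z)
    (polynomial-derivatives (geom (suc k))) (polynomial-derivatives ((1 , j) ∷ []))
    (polynomial-iterates (suc k) ((1 , j) ∷ [])) (fromℕ 0) tt tt
    (geom-derivatives-at-0 (suc k) 0 z<s)
    (λ i i≤s → geom-derivatives-at-0 (suc k) i (s≤s (ℕₚ.≤-trans i≤s s≤k)))
    (λ i → monomial-derivatives-at-0 i j) (monomial-derivative-at-0 j)
    (λ n → trans (iterate-at-0 (suc k) k ((1 , j) ∷ []) n) (cong ι (valueAt0-monomial (suc k) k j)))
  where
  s≤k : suc r ≤ k
  s≤k = ℕₚ.≤-trans (ℕₚ.m≤n+m (suc r) j) (ℕₚ.≤-reflexive j+s≡k)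

corollary3p4 : (c : Coefficients) → IsUniversal c →
    ∀ (k : ℕ) → 1 ≤ k → ∀ (s : ℕ) → s ≤ k →
    ∑∑ s (λ m α → ∏ (allFin s) (λ i → fromℕ (suc (toℕ i) !) ^ lookup α i) * c k s m α)
    ≈ fromℕ ([2 s -1]!! *ℕ ((k +ℕ s ∸ 1) C (2 *ℕ s)))
corollary3p4 c (expansion , top) k 1≤k zero s≤k =
  ≈fromℕ-resp-≡ (fromℕ 1) (C0 (k +ℕ 0 ∸ 1)) (≐⇒≈ (fromℕ 1) (fromℕ 1) (λ _ → refl))
  where
  C0 : ∀ n → 1 ≡ 1 *ℕ (n C 0)
  C0 n = refl
corollary3p4 c (expansion , top) k 1≤k (suc r) s≤k = by-cases (ℕₚ.m≤n⇒m<n∨m≡n s≤k)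
  where
  by-cases : suc r < k ⊎ suc r ≡ k →
    ∑∑ (suc r) (λ m α → ∏ (allFin (suc r)) (λ i → fromℕ (suc (toℕ i) !) ^ lookup α i) * c k (suc r) m α)
    ≈ fromℕ ([2 suc r -1]!! *ℕ ((k +ℕ suc r ∸ 1) C (2 *ℕ suc r)))
  -- For s = k the right side vanishes too, since C(2s - 1, 2s) = 0.
  by-cases (inj₂ refl) = ≈fromℕ-resp-≡
    (∑∑ (suc r) (λ m α → ∏ (allFin (suc r)) (λ i → fromℕ (suc (toℕ i) !) ^ lookup α i) * c (suc r) (suc r) m α))
    (sym (top-value (suc r) (s≤s z≤n))) (top-null c top r)
  -- Now j = k - s is positive, and both evaluations of Aᵏ zʲ at 0 carry the nonzero factor j!.
  by-cases (inj₁ s<k) = cancel-factor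
    ([2 suc r -1]!! *ℕ ((k +ℕ suc r ∸ 1) C (2 *ℕ suc r))) ((k ∸ suc r) !) {{(k ∸ suc r) ℕₚ.!≢0}}
    (∑∑ (suc r) (λ m α → ∏ (allFin (suc r)) (λ i → fromℕ (suc (toℕ i) !) ^ lookup α i) * c k (suc r) m α))
    (monomialAt0-value k (k ∸ suc r) (suc r) (ℕₚ.m∸n+n≡m s≤k))
    (weightedSum*j! c expansion k (k ∸ suc r) r (ℕₚ.m<n⇒0<n∸m s<k) (ℕₚ.m∸n+n≡m s≤k))
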